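{- For any $a,b\in\mathbb{N}_0$ and $c\in\mathbb{N}$, $$t^{\star}(\{2\}^{a},c+3,\{2\}^{b})=-\frac{2}{\pi}\sum_{r=1}^{c+2}2^{r}\sum_{\substack{s_1+\cdots+s_r=c+2\\ s_1,\ldots,s_r\geq1}}t(\overline{2a+1+s_1},s_2,\ldots,s_{r-1},2b+1+s_r),$$ where for $r=1$ the term $t(\overline{2a+1+s_1},s_2,\ldots,s_{r-1},2b+1+s_r)$ means $t(\overline{2a+2b+4+c})$.
   Context: $t^{\star}(\boldsymbol{s})=\sum_{k_1\geq\cdots\geq k_r\geq1}\prod_{j}(2k_j-1)^{ -s_j}$ for an index with $s_1>1$; $\{2\}^a$ is $2$ repeated $a$ times. Alternating multiple $t$-values: $t(\boldsymbol{s};\boldsymbol{\sigma})=\sum_{k_1>\cdots>k_r\geq1}\prod_{j}\frac{\sigma_j^{k_j}}{(2k_j-1)^{s_j}}$, where a bar over $s_j$ means $\sigma_j=-1$ and no bar means $\sigma_j=1$ (so only the first argument carries sign $-1$ here). -}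

module Defs where

open import Data.Nat.Base as ℕ using (ℕ; zero; suc)
import Data.Nat.Properties as ℕ
import Data.Integer.Base as ℤ
import Data.Integer.Properties as ℤ
open import Data.Rational.Base hiding (_≃_)
open import Data.Rational.Properties
import Data.Rational.Unnormalised.Base as ℚᵘ
import Data.Rational.Unnormalised.Properties as ℚᵘ
open import Data.Rational.Solver using (module +-*-Solver)
open import Algebra.Definitions.RawSemiring +-*-rawSemiring using (_^_)
open import Data.Sign.Base as Sign using (Sign)
open import Data.Empty using (⊥)
open import Data.Product.Base using (∃; _×_; _,_; proj₁; proj₂)
open import Data.List.Base as List using (List; []; _∷_; _++_; foldr; map)
open import Data.List.Relation.Unary.All using (All; []; _∷_)
import Data.List.Relation.Unary.All.Properties as All
open import Data.List.Relation.Unary.Any using (here)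
open import Data.List.Relation.Unary.Unique.Propositional using (Unique)
import Data.List.Relation.Unary.Unique.Propositional.Properties as Unique
import Data.List.Relation.Unary.AllPairs as AllPairs
open import Data.List.Membership.Propositional using (_∈_)
open import Data.List.Membership.Propositional.Properties using (∈-map⁺; ∈-map⁻; ∈-++⁺ˡ; ∈-++⁺ʳ)
open import Data.Vec.Base as Vec using (Vec; []; _∷_)
import Data.Vec.Properties as Vec
import Data.Vec.Relation.Unary.All as Vec
open import Relation.Nullary.Decidable using (yes; no)
open import Relation.Nullary.Negation using (contradiction)
open import Relation.Binary.PropositionalEquality

fromℕ : ℕ → ℚ
fromℕ n = ℤ.+ n / 1

2ℚ : ℚ
2ℚ = 1ℚ + 1ℚ

0≤1 : 0ℚ ≤ 1ℚ
0≤1 = nonNegative⁻¹ 1ℚ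

0<2 : 0ℚ < 2ℚ
0<2 = positive⁻¹ 2ℚ

0≤+ : ∀ {p q} → 0ℚ ≤ p → 0ℚ ≤ q → 0ℚ ≤ p + q
0≤+ {p} {q} 0≤p 0≤q = subst (_≤ p + q) (+-identityˡ 0ℚ) (+-mono-≤ 0≤p 0≤q)

0≤* : ∀ {p q} → 0ℚ ≤ p → 0ℚ ≤ q → 0ℚ ≤ p * q
0≤* {p} {q} 0≤p 0≤q =
  nonNegative⁻¹ (p * q) {{nonNeg*nonNeg⇒nonNeg p {{nonNegative 0≤p}} q {{nonNegative 0≤q}}}}

0<* : ∀ {p q} → 0ℚ < p → 0ℚ < q → 0ℚ < p * q
0<* {p} {q} 0<p 0<q = positive⁻¹ (p * q) {{pos*pos⇒pos p {{positive 0<p}} q {{positive 0<q}}}}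

0<+ : ∀ {p q} → 0ℚ ≤ p → 0ℚ < q → 0ℚ < p + q
0<+ {p} {q} 0≤p 0<q = subst (_< p + q) (+-identityˡ 0ℚ) (+-mono-≤-< 0≤p 0<q)

*-mono : ∀ {p q r s} → 0ℚ ≤ p → 0ℚ ≤ s → p ≤ q → r ≤ s → p * r ≤ q * s
*-mono {p} {q} {r} {s} 0≤p 0≤s p≤q r≤s =
  ≤-trans (*-monoˡ-≤-nonNeg p {{nonNegative 0≤p}} r≤s) (*-monoʳ-≤-nonNeg s {{nonNegative 0≤s}} p≤q)

*-monoˡ : ∀ {p q r} → 0ℚ ≤ r → p ≤ q → r * p ≤ r * q
*-monoˡ {r = r} 0≤r = *-monoˡ-≤-nonNeg r {{nonNegative 0≤r}}

*-monoʳ : ∀ {p q r} → 0ℚ ≤ r → p ≤ q → p * r ≤ q * r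
*-monoʳ {r = r} 0≤r = *-monoʳ-≤-nonNeg r {{nonNegative 0≤r}}

≤-+ʳ : ∀ {p q} → 0ℚ ≤ q → p ≤ p + q
≤-+ʳ {p} {q} 0≤q = subst (_≤ p + q) (+-identityʳ p) (+-monoʳ-≤ p 0≤q)

≤⇒0≤- : ∀ {p q} → p ≤ q → 0ℚ ≤ q - p
≤⇒0≤- {p} {q} p≤q = subst (_≤ q - p) (+-inverseʳ p) (+-monoˡ-≤ (- p) p≤q)

0≤-⇒≤ : ∀ {p q} → 0ℚ ≤ q - p → p ≤ q
0≤-⇒≤ {p} {q} 0≤q-p = subst (p ≤_) (solve 2 (λ x y → x :+ (y :- x) := y) refl p q) (≤-+ʳ 0≤q-p)
  where open +-*-Solver

-≤ : ∀ {p q} → 0ℚ ≤ q → p - q ≤ p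
-≤ {p} {q} 0≤q = 0≤-⇒≤ (subst (0ℚ ≤_) (solve 2 (λ x y → y := x :- (x :- y)) refl p q) 0≤q)
  where open +-*-Solver

∣-∣-sym : ∀ p q → ∣ p - q ∣ ≡ ∣ q - p ∣
∣-∣-sym p q = trans (cong ∣_∣ (solve 2 (λ x y → x :- y := :- (y :- x)) refl p q)) (∣-p∣≡∣p∣ (q - p))
  where open +-*-Solver

∣-∣-triangle : ∀ p q r → ∣ p - r ∣ ≤ ∣ p - q ∣ + ∣ q - r ∣
∣-∣-triangle p q r = subst (λ z → ∣ z ∣ ≤ ∣ p - q ∣ + ∣ q - r ∣)
  (solve 3 (λ x y z → (x :- y) :+ (y :- z) := x :- z) refl p q r) (∣p+q∣≤∣p∣+∣q∣ (p - q) (q - r))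
  where open +-*-Solver

half : ∀ {ε} → 0ℚ < ε → ∃ λ δ → 0ℚ < δ × δ + δ ≡ ε
half {ε} 0<ε = ½ * ε , 0<* (positive⁻¹ ½) 0<ε ,
  trans (sym (*-distribʳ-+ ε ½ ½)) (*-identityˡ ε)

recip : ℚ → ℚ
recip q with q ≟ 0ℚ
... | yes _   = 0ℚ
... | no  q≢0 = 1/_ q {{≢-nonZero q≢0}}

recip-inverse : ∀ {q} → q ≢ 0ℚ → q * recip q ≡ 1ℚ
recip-inverse {q} q≢0 with q ≟ 0ℚ
... | yes q≡0  = contradiction q≡0 q≢0
... | no  q≢0′ = *-inverseʳ q {{≢-nonZero q≢0′}}

0<recip : ∀ {q} → 0ℚ < q → 0ℚ < recip q
0<recip {q} 0<q with q ≟ 0ℚ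
... | yes q≡0 = contradiction (sym q≡0) (<⇒≢ 0<q)
... | no  q≢0 = positive⁻¹ _ {{1/pos⇒pos q {{positive 0<q}}}}

1/n*n≡1 : ∀ n → (ℤ.+ 1 / suc n) * fromℕ (suc n) ≡ 1ℚ
1/n*n≡1 n = toℚᵘ-injective (ℚᵘ.≃-trans (toℚᵘ-homo-* (ℤ.+ 1 / suc n) (fromℕ (suc n)))
  (ℚᵘ.≃-trans (ℚᵘ.*-cong (toℚᵘ-fromℚᵘ (ℚᵘ.mkℚᵘ (ℤ.+ 1) n)) (toℚᵘ-fromℚᵘ (ℚᵘ.mkℚᵘ (ℤ.+ suc n) 0)))
    (ℚᵘ.*≡* (cong (ℤ.+_) (eq n)))))
  where
  eq : ∀ n → (1 ℕ.* suc n) ℕ.* 1 ≡ 1 ℕ.* (suc n ℕ.* 1)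
  eq n = ℕ.*-assoc 1 (suc n) 1

fromℕ-+ : ∀ m n → fromℕ (m ℕ.+ n) ≡ fromℕ m + fromℕ n
fromℕ-+ m n = sym (toℚᵘ-injective (ℚᵘ.≃-trans (toℚᵘ-homo-+ (fromℕ m) (fromℕ n))
  (ℚᵘ.≃-trans (ℚᵘ.+-cong (toℚᵘ-fromℚᵘ (ℚᵘ.mkℚᵘ (ℤ.+ m) 0)) (toℚᵘ-fromℚᵘ (ℚᵘ.mkℚᵘ (ℤ.+ n) 0)))
  (ℚᵘ.≃-trans (ℚᵘ.*≡* eq) (ℚᵘ.≃-sym (toℚᵘ-fromℚᵘ (ℚᵘ.mkℚᵘ (ℤ.+ (m ℕ.+ n)) 0)))))))
  where
  eq : (ℤ.+ m ℤ.* ℤ.+ 1 ℤ.+ ℤ.+ n ℤ.* ℤ.+ 1) ℤ.* ℤ.+ 1 ≡ ℤ.+ (m ℕ.+ n) ℤ.* ℤ.+ 1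
  eq = cong (ℤ._* ℤ.+ 1) (cong₂ ℤ._+_ (ℤ.*-identityʳ (ℤ.+ m)) (ℤ.*-identityʳ (ℤ.+ n)))

0<fromℕ : ∀ n → 0ℚ < fromℕ (suc n)
0<fromℕ zero    = positive⁻¹ 1ℚ
0<fromℕ (suc n) = subst (0ℚ <_) (sym (fromℕ-+ 1 (suc n))) (0<+ 0≤1 (0<fromℕ n))

0<1/n : ∀ n → 0ℚ < ℤ.+ 1 / suc n
0<1/n n = positive⁻¹ _ {{normalize-pos 1 (suc n)}}

archimedean : ∀ ε → 0ℚ < ε → ∃ λ N → 1ℚ < ε * fromℕ (suc N)
archimedean ε 0<ε = ↧ₙ ε , toℚᵘ-cancel-<
  (ℚᵘ.<-respʳ-≃ (ℚᵘ.≃-sym (ℚᵘ.≃-trans (toℚᵘ-homo-* ε (fromℕ (suc (↧ₙ ε))))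
     (ℚᵘ.*-congˡ {toℚᵘ ε} (toℚᵘ-fromℚᵘ (ℚᵘ.mkℚᵘ (ℤ.+ suc (↧ₙ ε)) 0)))))
     (lemma ε (positive 0<ε)))
  where
  lemma : ∀ ε → Positive ε → toℚᵘ 1ℚ ℚᵘ.< toℚᵘ ε ℚᵘ.* ℚᵘ.mkℚᵘ (ℤ.+ suc (↧ₙ ε)) 0
  lemma (mkℚ ℤ.+[1+ p ] d _) _ = ℚᵘ.*<* (subst₂ ℤ._<_
    (cong (ℤ.+_) (sym (trans (ℕ.*-identityˡ (suc d ℕ.* 1)) (ℕ.*-identityʳ (suc d)))))
    (cong (ℤ.+_) (sym (ℕ.*-identityʳ (suc p ℕ.* suc (suc d)))))
    (ℤ.+<+ (ℕ.m≤m+n (suc (suc d)) (p ℕ.* suc (suc d)))))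

IsCauchy : (ℕ → ℚ) → Set
IsCauchy x = ∀ ε → 0ℚ < ε → ∃ λ N → ∀ m n → N ℕ.≤ m → N ℕ.≤ n → ∣ x m - x n ∣ < ε

-- A real number is a Cauchy sequence of rationals; equality of reals is _≃_, not _≡_.
record ℝ : Set where
  constructor mkℝ
  field
    seq      : ℕ → ℚ
    isCauchy : IsCauchy seq

open ℝ public

infix  4 _≃_
infixl 6 _+ᴿ_
infixl 7 _*ᴿ_
infix  8 -ᴿ_

_≃_ : ℝ → ℝ → Set
x ≃ y = ∀ ε → 0ℚ < ε → ∃ λ N → ∀ n → N ℕ.≤ n → ∣ seq x n - seq y n ∣ < ε

fromℚ : ℚ → ℝ
fromℚ q = mkℝ (λ _ → q) λ ε 0<ε → 0 , λ _ _ _ _ → subst (λ z → ∣ z ∣ < ε) (sym (+-inverseʳ q)) 0<ε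

_+ᴿ_ : ℝ → ℝ → ℝ
seq      (x +ᴿ y) n = seq x n + seq y n
isCauchy (x +ᴿ y) ε 0<ε with half 0<ε
... | δ , 0<δ , refl with isCauchy x δ 0<δ | isCauchy y δ 0<δ
...   | M , xM | N , yN = M ℕ.+ N , λ m n p q → ≤-<-trans
  (subst (λ z → ∣ z ∣ ≤ ∣ seq x m - seq x n ∣ + ∣ seq y m - seq y n ∣)
    (solve 4 (λ a b c d → (a :- b) :+ (c :- d) := (a :+ c) :- (b :+ d)) refl
      (seq x m) (seq x n) (seq y m) (seq y n))
    (∣p+q∣≤∣p∣+∣q∣ (seq x m - seq x n) (seq y m - seq y n)))
  (+-mono-< (xM m n (ℕ.m+n≤o⇒m≤o M p) (ℕ.m+n≤o⇒m≤o M q)) (yN m n (ℕ.m+n≤o⇒n≤o M p) (ℕ.m+n≤o⇒n≤o M q)))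
  where open +-*-Solver

-ᴿ_ : ℝ → ℝ
seq      (-ᴿ x) n = - seq x n
isCauchy (-ᴿ x) ε 0<ε with isCauchy x ε 0<ε
... | N , xN = N , λ m n p q → subst (_< ε)
  (trans (∣-∣-sym (seq x m) (seq x n))
    (cong ∣_∣ (solve 2 (λ a b → b :- a := (:- a) :- (:- b)) refl (seq x m) (seq x n))))
  (xN m n p q)
  where open +-*-Solver

eventually-bounded : ∀ x → ∃ λ B → 0ℚ < B × ∃ λ N → ∀ n → N ℕ.≤ n → ∣ seq x n ∣ ≤ B
eventually-bounded x with isCauchy x 1ℚ (positive⁻¹ 1ℚ)
... | N , xN = ∣ seq x N ∣ + 1ℚ , 0<+ (0≤∣p∣ (seq x N)) (positive⁻¹ 1ℚ) , N , λ n p → ≤-trans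
  (subst (λ z → ∣ z ∣ ≤ ∣ seq x N ∣ + ∣ seq x n - seq x N ∣)
    (solve 2 (λ a b → a :+ (b :- a) := b) refl (seq x N) (seq x n))
    (∣p+q∣≤∣p∣+∣q∣ (seq x N) (seq x n - seq x N)))
  (+-monoʳ-≤ ∣ seq x N ∣ (<⇒≤ (xN n N p ℕ.≤-refl)))
  where open +-*-Solver

scale-recip : ∀ {B d δ} → 0ℚ < B → d < recip B * δ → B * d < δ
scale-recip {B} {d} {δ} 0<B d<δ/B = subst (B * d <_)
  (trans (sym (*-assoc B (recip B) δ))
    (trans (cong (_* δ) (recip-inverse (λ e → <⇒≢ 0<B (sym e)))) (*-identityˡ δ)))
  (*-monoʳ-<-pos B {{positive 0<B}} d<δ/B)

∣*∣-bound : ∀ {B δ} p q → 0ℚ < B → ∣ p ∣ ≤ B → ∣ q ∣ < recip B * δ → ∣ p * q ∣ < δ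
∣*∣-bound {B} p q 0<B p≤B q< = ≤-<-trans
  (subst (_≤ B * ∣ q ∣) (sym (∣p*q∣≡∣p∣*∣q∣ p q)) (*-monoʳ (0≤∣p∣ q) p≤B))
  (scale-recip 0<B q<)

∣*-*∣-bound : ∀ {δ} a b c d → ∣ a * (c - d) ∣ < δ → ∣ d * (a - b) ∣ < δ → ∣ a * c - b * d ∣ < δ + δ
∣*-*∣-bound {δ} a b c d h k = ≤-<-trans
  (subst (λ z → ∣ z ∣ ≤ ∣ a * (c - d) ∣ + ∣ d * (a - b) ∣)
    (solve 4 (λ a b c d → a :* (c :- d) :+ d :* (a :- b) := a :* c :- b :* d) refl a b c d)
    (∣p+q∣≤∣p∣+∣q∣ (a * (c - d)) (d * (a - b))))
  (+-mono-< h k)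
  where open +-*-Solver

*-isCauchy : ∀ x y → IsCauchy (λ n → seq x n * seq y n)
*-isCauchy x y ε 0<ε = (K ℕ.+ L) ℕ.+ (M ℕ.+ N) , λ m n p q →
  let
    p₁ = ℕ.m+n≤o⇒m≤o (K ℕ.+ L) p
    p₂ = ℕ.m+n≤o⇒n≤o (K ℕ.+ L) p
    q₁ = ℕ.m+n≤o⇒m≤o (K ℕ.+ L) q
    q₂ = ℕ.m+n≤o⇒n≤o (K ℕ.+ L) q
  in subst (∣ seq x m * seq y m - seq x n * seq y n ∣ <_) δ+δ≡ε
    (∣*-*∣-bound (seq x m) (seq x n) (seq y m) (seq y n)
      (∣*∣-bound (seq x m) (seq y m - seq y n) 0<B (xB m (ℕ.m+n≤o⇒m≤o K p₁))
        (yN m n (ℕ.m+n≤o⇒n≤o M p₂) (ℕ.m+n≤o⇒n≤o M q₂)))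
      (∣*∣-bound (seq y n) (seq x m - seq x n) 0<C (yC n (ℕ.m+n≤o⇒n≤o K q₁))
        (xM m n (ℕ.m+n≤o⇒m≤o M p₂) (ℕ.m+n≤o⇒m≤o M q₂))))
  where
  δ     = proj₁ (half 0<ε)
  0<δ   = proj₁ (proj₂ (half 0<ε))
  δ+δ≡ε = proj₂ (proj₂ (half 0<ε))
  B     = proj₁ (eventually-bounded x)
  0<B   = proj₁ (proj₂ (eventually-bounded x))
  K     = proj₁ (proj₂ (proj₂ (eventually-bounded x)))
  xB    = proj₂ (proj₂ (proj₂ (eventually-bounded x)))
  C     = proj₁ (eventually-bounded y)
  0<C   = proj₁ (proj₂ (eventually-bounded y))
  L     = proj₁ (proj₂ (proj₂ (eventually-bounded y)))
  yC    = proj₂ (proj₂ (proj₂ (eventually-bounded y)))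
  xc    = isCauchy x (recip C * δ) (0<* (0<recip 0<C) 0<δ)
  M     = proj₁ xc
  xM    = proj₂ xc
  yc    = isCauchy y (recip B * δ) (0<* (0<recip 0<B) 0<δ)
  N     = proj₁ yc
  yN    = proj₂ yc

_*ᴿ_ : ℝ → ℝ → ℝ
x *ᴿ y = mkℝ (λ n → seq x n * seq y n) (*-isCauchy x y)

_#0 : ℝ → Set
x #0 = ∃ λ δ → 0ℚ < δ × ∃ λ N → ∀ n → N ℕ.≤ n → δ ≤ ∣ seq x n ∣

inv : (x : ℝ) → x #0 → ℝ
seq      (inv x _) n = recip (seq x n)
isCauchy (inv x (δ , 0<δ , K , δ≤x)) ε 0<ε with isCauchy x (ε * (δ * δ)) (0<* 0<ε (0<* 0<δ 0<δ))
... | M , xM = K ℕ.+ M , λ m n p q →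
  bound (seq x m) (seq x n) (δ≤x m (ℕ.m+n≤o⇒m≤o K p)) (δ≤x n (ℕ.m+n≤o⇒m≤o K q))
    (xM m n (ℕ.m+n≤o⇒n≤o K p) (ℕ.m+n≤o⇒n≤o K q))
  where
  open +-*-Solver
  ≢0 : ∀ a → δ ≤ ∣ a ∣ → a ≢ 0ℚ
  ≢0 .0ℚ δ≤0 refl = contradiction refl (<⇒≢ (<-≤-trans 0<δ δ≤0))
  bound : ∀ a b → δ ≤ ∣ a ∣ → δ ≤ ∣ b ∣ → ∣ a - b ∣ < ε * (δ * δ) → ∣ recip a - recip b ∣ < ε
  bound a b δ≤a δ≤b a-b< = *-cancelʳ-<-nonNeg (δ * δ) {{nonNegative 0≤δδ}} (≤-<-trans
    (*-monoˡ (0≤∣p∣ (recip a - recip b)) (*-mono (<⇒≤ 0<δ) (0≤∣p∣ b) δ≤a δ≤b))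
    (subst (_< ε * (δ * δ)) eq a-b<))
    where
    0≤δδ = <⇒≤ (0<* 0<δ 0<δ)
    A = recip-inverse (≢0 a δ≤a)
    B = recip-inverse (≢0 b δ≤b)
    eq : ∣ a - b ∣ ≡ ∣ recip a - recip b ∣ * (∣ a ∣ * ∣ b ∣)
    eq = begin
      ∣ a - b ∣                                     ≡⟨ ∣-∣-sym a b ⟩
      ∣ b - a ∣                                     ≡⟨ cong ∣_∣ (cong₂ _-_ (*-identityˡ b) (*-identityˡ a)) ⟨
      ∣ 1ℚ * b - 1ℚ * a ∣                           ≡⟨ cong ∣_∣ (cong₂ (λ u v → u * b - v * a) A B) ⟨
      ∣ (a * recip a) * b - (b * recip b) * a ∣     ≡⟨ cong ∣_∣ (solve 4 (λ a b u v → (a :* u) :* b :- (b :* v) :* a := (u :- v) :* (a :* b)) refl a b (recip a) (recip b)) ⟩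
      ∣ (recip a - recip b) * (a * b) ∣             ≡⟨ ∣p*q∣≡∣p∣*∣q∣ (recip a - recip b) (a * b) ⟩
      ∣ recip a - recip b ∣ * ∣ a * b ∣             ≡⟨ cong (∣ recip a - recip b ∣ *_) (∣p*q∣≡∣p∣*∣q∣ a b) ⟩
      ∣ recip a - recip b ∣ * (∣ a ∣ * ∣ b ∣)       ∎
      where open ≡-Reasoning

sumOver : ∀ {A : Set} → List A → (A → ℝ) → ℝ
sumOver xs f = foldr (λ x s → f x +ᴿ s) (fromℚ 0ℚ) xs

infix 5 sumOver
syntax sumOver xs (λ x → e) = ∑[ x ← xs ] e

-- recipOdd (k - 1) is 1 / (2k - 1).
recipOdd : ℕ → ℚ
recipOdd n = ℤ.+ 1 / suc (2 ℕ.* n)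

signℚ : Sign → ℚ
signℚ Sign.+ = 1ℚ
signℚ Sign.- = - 1ℚ

-- The part n ≥ k₁ > ⋯ > k_r ≥ 1 of the series t(s; σ); the last summand has k₁ = suc n.
tSum : List (ℕ × Sign) → ℕ → ℚ
tSum []            n       = 1ℚ
tSum (_ ∷ _)       zero    = 0ℚ
tSum ((s , σ) ∷ w) (suc n) = tSum ((s , σ) ∷ w) n + signℚ σ ^ suc n * recipOdd n ^ s * tSum w n

-- The part n ≥ k₁ ≥ ⋯ ≥ k_r ≥ 1 of the series t⋆(s).
t⋆Sum : List ℕ → ℕ → ℚ
t⋆Sum []      n       = 1ℚ
t⋆Sum (_ ∷ _) zero    = 0ℚ
t⋆Sum (s ∷ w) (suc n) = t⋆Sum (s ∷ w) n + recipOdd n ^ s * t⋆Sum w (suc n)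

leibnizSum : ℕ → ℚ
leibnizSum zero    = 0ℚ
leibnizSum (suc n) = leibnizSum n + (- 1ℚ) ^ n * recipOdd n

Admissible : List ℕ → Set
Admissible []      = ⊥
Admissible (s ∷ w) = 1 ℕ.< s × All (1 ℕ.≤_) w

-- With y_n = recipOdd n, P n = (1 + y₀) ⋯ (1 + y_{n-1}) dominates the inner sums, and
-- Q n = P n * y_n tends to 0 with Q n - Q (n + 1) = P n * y_n * y_{n+1}.

0<recipOdd : ∀ n → 0ℚ < recipOdd n
0<recipOdd n = 0<1/n (2 ℕ.* n)

0≤recipOdd : ∀ n → 0ℚ ≤ recipOdd n
0≤recipOdd n = <⇒≤ (0<recipOdd n)

odd : ℕ → ℚ
odd n = fromℕ (suc (2 ℕ.* n))

recipOdd*odd : ∀ n → recipOdd n * odd n ≡ 1ℚ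
recipOdd*odd n = 1/n*n≡1 (2 ℕ.* n)

odd-suc : ∀ n → odd (suc n) ≡ 2ℚ + odd n
odd-suc n = trans (cong (λ k → fromℕ (suc k)) (ℕ.*-suc 2 n)) (fromℕ-+ 2 (suc (2 ℕ.* n)))

recipOdd-diff : ∀ n → recipOdd n - recipOdd (suc n) ≡ 2ℚ * (recipOdd n * recipOdd (suc n))
recipOdd-diff n = begin
  y - z                                 ≡⟨ cong₂ _-_ (*-identityʳ y) (*-identityʳ z) ⟨
  y * 1ℚ - z * 1ℚ                       ≡⟨ cong₂ (λ u v → y * u - z * v) (recipOdd*odd (suc n)) (recipOdd*odd n) ⟨
  y * (z * odd (suc n)) - z * (y * o)   ≡⟨ cong (λ u → y * (z * u) - z * (y * o)) (odd-suc n) ⟩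
  y * (z * (2ℚ + o)) - z * (y * o)      ≡⟨ solve 4 (λ y z o t → y :* (z :* (t :+ o)) :- z :* (y :* o) := t :* (y :* z)) refl y z o 2ℚ ⟩
  2ℚ * (y * z)                          ∎
  where
  open +-*-Solver
  open ≡-Reasoning
  y = recipOdd n
  z = recipOdd (suc n)
  o = odd n

recipOdd-antitone : ∀ n → recipOdd (suc n) ≤ recipOdd n
recipOdd-antitone n = 0≤-⇒≤ (subst (0ℚ ≤_) (sym (recipOdd-diff n))
  (0≤* (<⇒≤ 0<2) (0≤* (0≤recipOdd n) (0≤recipOdd (suc n)))))

recipOdd≤1 : ∀ n → recipOdd n ≤ 1ℚ
recipOdd≤1 zero    = ≤-refl
recipOdd≤1 (suc n) = ≤-trans (recipOdd-antitone n) (recipOdd≤1 n)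

3ℚ : ℚ
3ℚ = 1ℚ + 2ℚ

recipOdd≤3* : ∀ n → recipOdd n ≤ 3ℚ * recipOdd (suc n)
recipOdd≤3* n = subst (_≤ 3ℚ * z) eq (*-monoʳ (0≤recipOdd (suc n))
  (+-monoʳ-≤ 1ℚ (subst (2ℚ * y ≤_) (*-identityʳ 2ℚ) (*-monoˡ (<⇒≤ 0<2) (recipOdd≤1 n)))))
  where
  open +-*-Solver
  y = recipOdd n
  z = recipOdd (suc n)
  eq : (1ℚ + 2ℚ * y) * z ≡ y
  eq = trans (solve 3 (λ y z t → (con 1ℚ :+ t :* y) :* z := z :+ t :* (y :* z)) refl y z 2ℚ)
    (trans (cong (z +_) (sym (recipOdd-diff n))) (solve 2 (λ y z → z :+ (y :- z) := y) refl y z))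

P : ℕ → ℚ
P zero    = 1ℚ
P (suc n) = P n * (1ℚ + recipOdd n)

1≤P : ∀ n → 1ℚ ≤ P n
1≤P zero    = ≤-refl
1≤P (suc n) = ≤-trans (1≤P n) (subst (_≤ P (suc n)) (*-identityʳ (P n))
  (*-monoˡ (≤-trans 0≤1 (1≤P n)) (≤-+ʳ (0≤recipOdd n))))

0≤P : ∀ n → 0ℚ ≤ P n
0≤P n = ≤-trans 0≤1 (1≤P n)

Q : ℕ → ℚ
Q n = P n * recipOdd n

0≤Q : ∀ n → 0ℚ ≤ Q n
0≤Q n = 0≤* (0≤P n) (0≤recipOdd n)

Q-diff : ∀ n → Q n - Q (suc n) ≡ Q n * recipOdd (suc n)
Q-diff n = begin
  p * y - p * (1ℚ + y) * z         ≡⟨ solve 3 (λ p y z → p :* y :- p :* (con 1ℚ :+ y) :* z := p :* ((y :- z) :- y :* z)) refl p y z ⟩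
  p * ((y - z) - y * z)            ≡⟨ cong (λ u → p * (u - y * z)) (recipOdd-diff n) ⟩
  p * (2ℚ * (y * z) - y * z)       ≡⟨ solve 3 (λ p y z → p :* ((con 1ℚ :+ con 1ℚ) :* (y :* z) :- y :* z) := p :* y :* z) refl p y z ⟩
  p * y * z                        ∎
  where
  open +-*-Solver
  open ≡-Reasoning
  p = P n
  y = recipOdd n
  z = recipOdd (suc n)

Q²n≤1 : ∀ n → Q n * Q n * fromℕ (suc n) ≤ 1ℚ
Q²n≤1 zero    = ≤-refl
Q²n≤1 (suc n) = begin
  Q (suc n) * Q (suc n) * fromℕ (suc (suc n))   ≡⟨ cong₂ (λ a b → a * a * b) Q-suc (fromℕ-+ 1 (suc n)) ⟩
  (q * (1ℚ - z)) * (q * (1ℚ - z)) * (1ℚ + u)    ≡⟨ cong (λ a → (q * (a - z)) * (q * (a - z)) * (1ℚ + u)) zo ⟨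
  (q * (z * (1ℚ + (u + u)) - z)) * (q * (z * (1ℚ + (u + u)) - z)) * (1ℚ + u)
    ≡⟨ solve 3 (λ q z u → (q :* (z :* (con 1ℚ :+ (u :+ u)) :- z)) :* (q :* (z :* (con 1ℚ :+ (u :+ u)) :- z)) :* (con 1ℚ :+ u)
          := (q :* q :* u) :* ((z :* (con 1ℚ :+ (u :+ u))) :* (z :* (con 1ℚ :+ (u :+ u))) :- z :* z)) refl q z u ⟩
  (q * q * u) * ((z * (1ℚ + (u + u))) * (z * (1ℚ + (u + u))) - z * z)   ≡⟨ cong (λ a → (q * q * u) * (a * a - z * z)) zo ⟩
  (q * q * u) * (1ℚ * 1ℚ - z * z)   ≤⟨ *-monoˡ (0≤* (0≤* (0≤Q n) (0≤Q n)) (<⇒≤ (0<fromℕ n))) (-≤ {1ℚ} (0≤* (0≤recipOdd (suc n)) (0≤recipOdd (suc n)))) ⟩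
  (q * q * u) * 1ℚ                  ≡⟨ *-identityʳ (q * q * u) ⟩
  q * q * u                         ≤⟨ Q²n≤1 n ⟩
  1ℚ                                ∎
  where
  open +-*-Solver
  open ≤-Reasoning
  q = Q n
  z = recipOdd (suc n)
  u = fromℕ (suc n)
  zo : z * (1ℚ + (u + u)) ≡ 1ℚ
  zo = trans (cong (z *_) (sym (trans (fromℕ-+ 1 (2 ℕ.* suc n)) (cong (1ℚ +_)
         (trans (cong (λ k → fromℕ (suc n ℕ.+ k)) (ℕ.+-identityʳ (suc n))) (fromℕ-+ (suc n) (suc n)))))))
       (recipOdd*odd (suc n))
  Q-suc : Q (suc n) ≡ q * (1ℚ - z)
  Q-suc = trans (solve 2 (λ a b → b := a :- (a :- b)) refl q (Q (suc n)))
    (trans (cong (λ d → q - d) (Q-diff n)) (solve 2 (λ q z → q :- q :* z := q :* (con 1ℚ :- z)) refl q z))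

Q→0 : ∀ ε → 0ℚ < ε → ∃ λ N → Q N < ε
Q→0 ε 0<ε with archimedean (ε * ε) (0<* 0<ε 0<ε)
... | N , big = N , ≰⇒> λ ε≤Q → contradiction refl (<⇒≢ (<-≤-trans big (≤-trans
  (*-monoʳ (<⇒≤ (0<fromℕ N)) (*-mono (<⇒≤ 0<ε) (0≤Q N) ε≤Q ε≤Q)) (Q²n≤1 N))))

tail⇒cauchy : ∀ (x : ℕ → ℚ) C → 0ℚ < C → (∀ n j → ∣ x (j ℕ.+ n) - x n ∣ ≤ C * Q n) → IsCauchy x
tail⇒cauchy x C 0<C tail ε 0<ε = N , λ m n p q → ≤-<-trans (∣-∣-triangle (x m) (x N) (x n))
  (subst (∣ x m - x N ∣ + ∣ x N - x n ∣ <_) δ+δ≡ε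
    (+-mono-< (near m p) (subst (_< δ) (∣-∣-sym (x n) (x N)) (near n q))))
  where
  δ     = proj₁ (half 0<ε)
  0<δ   = proj₁ (proj₂ (half 0<ε))
  δ+δ≡ε = proj₂ (proj₂ (half 0<ε))
  small = Q→0 (recip C * δ) (0<* (0<recip 0<C) 0<δ)
  N     = proj₁ small
  near : ∀ m → N ℕ.≤ m → ∣ x m - x N ∣ < δ
  near m N≤m = ≤-<-trans
    (subst (λ k → ∣ x k - x N ∣ ≤ C * Q N) (ℕ.m∸n+n≡m N≤m) (tail N (m ℕ.∸ N)))
    (scale-recip 0<C (proj₂ small))

terms⇒cauchy : ∀ (x d : ℕ → ℚ) C → 0ℚ < C → (∀ n → x (suc n) ≡ x n + d n) →
               (∀ n → ∣ d n ∣ ≤ C * (Q n - Q (suc n))) → IsCauchy x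
terms⇒cauchy x d C 0<C step bound = tail⇒cauchy x C 0<C λ n j →
  ≤-trans (tele n j) (*-monoˡ (<⇒≤ 0<C) (-≤ (0≤Q (j ℕ.+ n))))
  where
  open +-*-Solver
  open ≤-Reasoning
  tele : ∀ n j → ∣ x (j ℕ.+ n) - x n ∣ ≤ C * (Q n - Q (j ℕ.+ n))
  tele n zero = ≤-reflexive (trans (cong ∣_∣ (+-inverseʳ (x n)))
    (sym (trans (cong (C *_) (+-inverseʳ (Q n))) (*-zeroʳ C))))
  tele n (suc j) = begin
    ∣ x (suc (j ℕ.+ n)) - x n ∣                 ≡⟨ cong (λ z → ∣ z - x n ∣) (step (j ℕ.+ n)) ⟩
    ∣ (x (j ℕ.+ n) + d (j ℕ.+ n)) - x n ∣       ≡⟨ cong ∣_∣ (solve 3 (λ a b c → (a :+ b) :- c := (a :- c) :+ b) refl (x (j ℕ.+ n)) (d (j ℕ.+ n)) (x n)) ⟩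
    ∣ (x (j ℕ.+ n) - x n) + d (j ℕ.+ n) ∣       ≤⟨ ∣p+q∣≤∣p∣+∣q∣ (x (j ℕ.+ n) - x n) (d (j ℕ.+ n)) ⟩
    ∣ x (j ℕ.+ n) - x n ∣ + ∣ d (j ℕ.+ n) ∣     ≤⟨ +-mono-≤ (tele n j) (bound (j ℕ.+ n)) ⟩
    C * (Q n - Q (j ℕ.+ n)) + C * (Q (j ℕ.+ n) - Q (suc (j ℕ.+ n)))
      ≡⟨ solve 4 (λ c a b e → c :* (a :- b) :+ c :* (b :- e) := c :* (a :- e)) refl C (Q n) (Q (j ℕ.+ n)) (Q (suc (j ℕ.+ n))) ⟩
    C * (Q n - Q (suc (j ℕ.+ n)))               ∎

∣sign∣ : ∀ σ k → ∣ signℚ σ ^ k ∣ ≡ 1ℚ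
∣sign∣ σ zero    = refl
∣sign∣ σ (suc k) = trans (∣p*q∣≡∣p∣*∣q∣ (signℚ σ) (signℚ σ ^ k))
  (trans (cong₂ _*_ (one σ) (∣sign∣ σ k)) (*-identityˡ 1ℚ))
  where
  one : ∀ σ → ∣ signℚ σ ∣ ≡ 1ℚ
  one Sign.+ = refl
  one Sign.- = refl

0≤pow : ∀ n s → 0ℚ ≤ recipOdd n ^ s
0≤pow n zero    = 0≤1
0≤pow n (suc s) = 0≤* (0≤recipOdd n) (0≤pow n s)

pow≤1 : ∀ n s → recipOdd n ^ s ≤ 1ℚ
pow≤1 n zero    = ≤-refl
pow≤1 n (suc s) = subst (recipOdd n ^ suc s ≤_) (*-identityˡ 1ℚ)
  (*-mono (0≤recipOdd n) 0≤1 (recipOdd≤1 n) (pow≤1 n s))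

pow≤y : ∀ n {s} → 1 ℕ.≤ s → recipOdd n ^ s ≤ recipOdd n
pow≤y n {suc s} _ = subst (recipOdd n ^ suc s ≤_) (*-identityʳ (recipOdd n))
  (*-monoˡ (0≤recipOdd n) (pow≤1 n s))

pow≤y² : ∀ n {s} → 1 ℕ.< s → recipOdd n ^ s ≤ recipOdd n * recipOdd n
pow≤y² n {suc s} (ℕ.s≤s 1≤s) = *-monoˡ (0≤recipOdd n) (pow≤y n 1≤s)

∣pow∣ : ∀ n s → ∣ recipOdd n ^ s ∣ ≡ recipOdd n ^ s
∣pow∣ n s = 0≤p⇒∣p∣≡p (0≤pow n s)

∣tTerm∣ : ∀ s σ n r → ∣ signℚ σ ^ suc n * recipOdd n ^ s * r ∣ ≡ recipOdd n ^ s * ∣ r ∣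
∣tTerm∣ s σ n r = begin
  ∣ e * p * r ∣           ≡⟨ ∣p*q∣≡∣p∣*∣q∣ (e * p) r ⟩
  ∣ e * p ∣ * ∣ r ∣       ≡⟨ cong (_* ∣ r ∣) (∣p*q∣≡∣p∣*∣q∣ e p) ⟩
  ∣ e ∣ * ∣ p ∣ * ∣ r ∣   ≡⟨ cong₂ (λ a b → a * b * ∣ r ∣) (∣sign∣ σ (suc n)) (∣pow∣ n s) ⟩
  1ℚ * p * ∣ r ∣          ≡⟨ cong (_* ∣ r ∣) (*-identityˡ p) ⟩
  p * ∣ r ∣               ∎
  where
  open ≡-Reasoning
  e = signℚ σ ^ suc n
  p = recipOdd n ^ s

tSum-bound : ∀ w → All (1 ℕ.≤_) (map proj₁ w) → ∀ n → ∣ tSum w n ∣ ≤ P n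
tSum-bound []            []        n       = 1≤P n
tSum-bound (_ ∷ _)       (_ ∷ _)   zero    = 0≤1
tSum-bound ((s , σ) ∷ w) (1≤s ∷ h) (suc n) = begin
  ∣ tSum ((s , σ) ∷ w) n + d ∣           ≤⟨ ∣p+q∣≤∣p∣+∣q∣ (tSum ((s , σ) ∷ w) n) d ⟩
  ∣ tSum ((s , σ) ∷ w) n ∣ + ∣ d ∣       ≡⟨ cong (∣ tSum ((s , σ) ∷ w) n ∣ +_) (∣tTerm∣ s σ n (tSum w n)) ⟩
  ∣ tSum ((s , σ) ∷ w) n ∣ + recipOdd n ^ s * ∣ tSum w n ∣
    ≤⟨ +-mono-≤ (tSum-bound ((s , σ) ∷ w) (1≤s ∷ h) n) (*-mono (0≤pow n s) (0≤P n) (pow≤y n 1≤s) (tSum-bound w h n)) ⟩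
  P n + recipOdd n * P n                 ≡⟨ solve 2 (λ p y → p :+ y :* p := p :* (con 1ℚ :+ y)) refl (P n) (recipOdd n) ⟩
  P n * (1ℚ + recipOdd n)                ∎
  where
  open +-*-Solver
  open ≤-Reasoning
  d = signℚ σ ^ suc n * recipOdd n ^ s * tSum w n

0<3 : 0ℚ < 3ℚ
0<3 = positive⁻¹ 3ℚ

y²P≤3ΔQ : ∀ n → recipOdd n * recipOdd n * P n ≤ 3ℚ * (Q n - Q (suc n))
y²P≤3ΔQ n = begin
  y * y * p              ≡⟨ solve 2 (λ y p → y :* y :* p := p :* y :* y) refl y p ⟩
  p * y * y              ≤⟨ *-monoˡ (0≤Q n) (recipOdd≤3* n) ⟩
  p * y * (3ℚ * z)       ≡⟨ solve 3 (λ q z t → q :* (t :* z) := t :* (q :* z)) refl (Q n) z 3ℚ ⟩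
  3ℚ * (p * y * z)       ≡⟨ cong (3ℚ *_) (Q-diff n) ⟨
  3ℚ * (Q n - Q (suc n)) ∎
  where
  open +-*-Solver
  open ≤-Reasoning
  p = P n
  y = recipOdd n
  z = recipOdd (suc n)

tSum-cauchy : ∀ w → Admissible (map proj₁ w) → IsCauchy (tSum w)
tSum-cauchy ((s , σ) ∷ w) (1<s , h) = terms⇒cauchy (tSum ((s , σ) ∷ w))
  (λ n → signℚ σ ^ suc n * recipOdd n ^ s * tSum w n) 3ℚ 0<3 (λ _ → refl) λ n →
  ≤-trans (≤-reflexive (∣tTerm∣ s σ n (tSum w n)))
  (≤-trans (*-mono (0≤pow n s) (0≤P n) (pow≤y² n 1<s) (tSum-bound w h n)) (y²P≤3ΔQ n))

0<2^ : ∀ r → 0ℚ < 2ℚ ^ r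
0<2^ zero    = positive⁻¹ 1ℚ
0<2^ (suc r) = 0<* 0<2 (0<2^ r)

∣t⋆Term∣ : ∀ s n r → ∣ recipOdd n ^ s * r ∣ ≡ recipOdd n ^ s * ∣ r ∣
∣t⋆Term∣ s n r = trans (∣p*q∣≡∣p∣*∣q∣ (recipOdd n ^ s) r) (cong (_* ∣ r ∣) (∣pow∣ n s))

1+y≤2 : ∀ n → 1ℚ + recipOdd n ≤ 2ℚ
1+y≤2 n = +-monoʳ-≤ 1ℚ (recipOdd≤1 n)

t⋆Sum-bound : ∀ w → All (1 ℕ.≤_) w → ∀ n → ∣ t⋆Sum w n ∣ ≤ 2ℚ ^ List.length w * P n
t⋆Sum-bound []      []        n       = subst (1ℚ ≤_) (sym (*-identityˡ (P n))) (1≤P n)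
t⋆Sum-bound (s ∷ w) (_ ∷ _)   zero    = 0≤* (<⇒≤ (0<2^ (suc (List.length w)))) 0≤1
t⋆Sum-bound (s ∷ w) (1≤s ∷ h) (suc n) = begin
  ∣ t⋆Sum (s ∷ w) n + recipOdd n ^ s * t⋆Sum w (suc n) ∣       ≤⟨ ∣p+q∣≤∣p∣+∣q∣ (t⋆Sum (s ∷ w) n) (recipOdd n ^ s * t⋆Sum w (suc n)) ⟩
  ∣ t⋆Sum (s ∷ w) n ∣ + ∣ recipOdd n ^ s * t⋆Sum w (suc n) ∣   ≡⟨ cong (∣ t⋆Sum (s ∷ w) n ∣ +_) (∣t⋆Term∣ s n (t⋆Sum w (suc n))) ⟩
  ∣ t⋆Sum (s ∷ w) n ∣ + recipOdd n ^ s * ∣ t⋆Sum w (suc n) ∣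
    ≤⟨ +-mono-≤ (t⋆Sum-bound (s ∷ w) (1≤s ∷ h) n) (*-mono (0≤pow n s) (0≤* (<⇒≤ (0<2^ l)) (0≤P (suc n))) (pow≤y n 1≤s) (t⋆Sum-bound w h (suc n))) ⟩
  2ℚ * e * p + y * (e * (p * (1ℚ + y)))     ≡⟨ solve 4 (λ t e p y → t :* e :* p :+ y :* (e :* (p :* (con 1ℚ :+ y))) := t :* e :* p :+ (e :* p :* y) :* (con 1ℚ :+ y)) refl 2ℚ e p y ⟩
  2ℚ * e * p + (e * p * y) * (1ℚ + y)       ≤⟨ +-monoʳ-≤ (2ℚ * e * p) (*-monoˡ (0≤* (0≤* (<⇒≤ (0<2^ l)) (0≤P n)) (0≤recipOdd n)) (1+y≤2 n)) ⟩
  2ℚ * e * p + (e * p * y) * 2ℚ             ≡⟨ solve 4 (λ t e p y → t :* e :* p :+ (e :* p :* y) :* t := t :* e :* (p :* (con 1ℚ :+ y))) refl 2ℚ e p y ⟩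
  2ℚ * e * (p * (1ℚ + y))                   ∎
  where
  open +-*-Solver
  open ≤-Reasoning
  l = List.length w
  e = 2ℚ ^ l
  p = P n
  y = recipOdd n

t⋆Sum-cauchy : ∀ w → Admissible w → IsCauchy (t⋆Sum w)
t⋆Sum-cauchy (s ∷ w) (1<s , h) = terms⇒cauchy (t⋆Sum (s ∷ w))
  (λ n → recipOdd n ^ s * t⋆Sum w (suc n)) (e * 2ℚ * 3ℚ) (0<* (0<* (0<2^ l) 0<2) 0<3) (λ _ → refl) bound
  where
  open +-*-Solver
  open ≤-Reasoning
  l = List.length w
  e = 2ℚ ^ l
  bound : ∀ n → ∣ recipOdd n ^ s * t⋆Sum w (suc n) ∣ ≤ e * 2ℚ * 3ℚ * (Q n - Q (suc n))
  bound n = begin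
    ∣ recipOdd n ^ s * t⋆Sum w (suc n) ∣     ≡⟨ ∣t⋆Term∣ s n (t⋆Sum w (suc n)) ⟩
    recipOdd n ^ s * ∣ t⋆Sum w (suc n) ∣     ≤⟨ *-mono (0≤pow n s) (0≤* (<⇒≤ (0<2^ l)) (0≤P (suc n))) (pow≤y² n 1<s) (t⋆Sum-bound w h (suc n)) ⟩
    y * y * (e * (p * (1ℚ + y)))             ≡⟨ solve 3 (λ y e p → y :* y :* (e :* (p :* (con 1ℚ :+ y))) := (e :* (con 1ℚ :+ y)) :* (y :* y :* p)) refl y e p ⟩
    (e * (1ℚ + y)) * (y * y * p)             ≤⟨ *-mono (0≤* (<⇒≤ (0<2^ l)) (0≤+ 0≤1 (0≤recipOdd n))) 0≤ΔQ (*-monoˡ (<⇒≤ (0<2^ l)) (1+y≤2 n)) (y²P≤3ΔQ n) ⟩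
    (e * 2ℚ) * (3ℚ * (Q n - Q (suc n)))      ≡⟨ *-assoc (e * 2ℚ) 3ℚ (Q n - Q (suc n)) ⟨
    e * 2ℚ * 3ℚ * (Q n - Q (suc n))          ∎
    where
    p = P n
    y = recipOdd n
    0≤ΔQ : 0ℚ ≤ 3ℚ * (Q n - Q (suc n))
    0≤ΔQ = ≤-trans (0≤* (0≤* (0≤recipOdd n) (0≤recipOdd n)) (0≤P n)) (y²P≤3ΔQ n)

altTail : ℕ → ℕ → ℚ
altTail n zero    = 0ℚ
altTail n (suc j) = recipOdd n - altTail (suc n) j

altTail-bounds : ∀ n j → 0ℚ ≤ altTail n j × altTail n j ≤ recipOdd n
altTail-bounds n zero    = ≤-refl , 0≤recipOdd n
altTail-bounds n (suc j) with altTail-bounds (suc n) j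
... | lo , hi = ≤⇒0≤- (≤-trans hi (recipOdd-antitone n)) , -≤ lo

leibniz-tail : ∀ n j → leibnizSum (j ℕ.+ n) ≡ leibnizSum n + (- 1ℚ) ^ n * altTail n j
leibniz-tail n zero    = sym (trans (cong (leibnizSum n +_) (*-zeroʳ ((- 1ℚ) ^ n))) (+-identityʳ (leibnizSum n)))
leibniz-tail n (suc j) = begin
  leibnizSum (suc j ℕ.+ n)                          ≡⟨ cong leibnizSum (ℕ.+-suc j n) ⟨
  leibnizSum (j ℕ.+ suc n)                          ≡⟨ leibniz-tail (suc n) j ⟩
  (l + e * recipOdd n) + (- 1ℚ * e) * altTail (suc n) j
    ≡⟨ solve 4 (λ l e y a → (l :+ e :* y) :+ ((con (- 1ℚ)) :* e) :* a := l :+ e :* (y :- a)) refl l e (recipOdd n) (altTail (suc n) j) ⟩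
  l + e * (recipOdd n - altTail (suc n) j)          ∎
  where
  open +-*-Solver
  open ≡-Reasoning
  l = leibnizSum n
  e = (- 1ℚ) ^ n

leibnizSum-cauchy : IsCauchy leibnizSum
leibnizSum-cauchy = tail⇒cauchy leibnizSum 1ℚ (positive⁻¹ 1ℚ) λ n j → begin
  ∣ leibnizSum (j ℕ.+ n) - leibnizSum n ∣   ≡⟨ cong (λ z → ∣ z - leibnizSum n ∣) (leibniz-tail n j) ⟩
  ∣ (leibnizSum n + (- 1ℚ) ^ n * altTail n j) - leibnizSum n ∣
    ≡⟨ cong ∣_∣ (solve 2 (λ a b → (a :+ b) :- a := b) refl (leibnizSum n) ((- 1ℚ) ^ n * altTail n j)) ⟩
  ∣ (- 1ℚ) ^ n * altTail n j ∣              ≡⟨ ∣p*q∣≡∣p∣*∣q∣ ((- 1ℚ) ^ n) (altTail n j) ⟩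
  ∣ (- 1ℚ) ^ n ∣ * ∣ altTail n j ∣          ≡⟨ cong₂ _*_ (∣sign∣ Sign.- n) (0≤p⇒∣p∣≡p (proj₁ (altTail-bounds n j))) ⟩
  1ℚ * altTail n j                          ≤⟨ *-monoˡ 0≤1 (proj₂ (altTail-bounds n j)) ⟩
  1ℚ * recipOdd n                           ≤⟨ *-monoˡ 0≤1 (subst (_≤ Q n) (*-identityˡ (recipOdd n)) (*-monoʳ (0≤recipOdd n) (1≤P n))) ⟩
  1ℚ * Q n                                  ∎
  where
  open +-*-Solver
  open ≤-Reasoning

t : (w : List (ℕ × Sign)) → IsCauchy (tSum w) → ℝ
t w conv = mkℝ (tSum w) conv

t⋆ : (s : List ℕ) → Admissible s → ℝ
t⋆ s adm = mkℝ (t⋆Sum s) (t⋆Sum-cauchy s adm)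

-- π = 4 (1 - 1/3 + 1/5 - ⋯)
π : ℝ
π = fromℚ (fromℕ 4) *ᴿ mkℝ leibnizSum leibnizSum-cauchy

π#0 : π #0
π#0 = 1ℚ , positive⁻¹ 1ℚ , 2 , λ n 2≤n → subst (λ k → 1ℚ ≤ ∣ fromℕ 4 * leibnizSum k ∣) (ℕ.m∸n+n≡m 2≤n) (lower (n ℕ.∸ 2))
  where
  open ≤-Reasoning
  lower : ∀ j → 1ℚ ≤ ∣ fromℕ 4 * leibnizSum (j ℕ.+ 2) ∣
  lower j = subst (1ℚ ≤_) (sym (0≤p⇒∣p∣≡p (≤-trans 0≤1 big))) big
    where
    big : 1ℚ ≤ fromℕ 4 * leibnizSum (j ℕ.+ 2)
    big = begin
      1ℚ                                        ≤⟨ ≤ᵇ⇒≤ _ ⟩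
      fromℕ 4 * leibnizSum 2                    ≤⟨ *-monoˡ {r = fromℕ 4} (nonNegative⁻¹ _) (≤-+ʳ {leibnizSum 2} (0≤* {1ℚ} 0≤1 (proj₁ (altTail-bounds 2 j)))) ⟩
      fromℕ 4 * (leibnizSum 2 + 1ℚ * altTail 2 j) ≡⟨ cong (fromℕ 4 *_) (leibniz-tail 2 j) ⟨
      fromℕ 4 * leibnizSum (j ℕ.+ 2)            ∎

record Composition (r n : ℕ) : Set where
  constructor mkComposition
  field
    parts          : Vec ℕ r
    parts-positive : Vec.All (1 ℕ.≤_) parts
    parts-total    : Vec.sum parts ≡ n

open Composition public using (parts)

prepend-1 : ∀ {r n} → Composition r n → Composition (suc r) (suc n)
prepend-1 (mkComposition v pos tot) = mkComposition (1 ∷ v) (ℕ.s≤s ℕ.z≤n Vec.∷ pos) (cong suc tot)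

increment-head : ∀ {r n} → Composition (suc r) n → Composition (suc r) (suc n)
increment-head (mkComposition (s ∷ v) (_ Vec.∷ pos) tot) =
  mkComposition (suc s ∷ v) (ℕ.s≤s ℕ.z≤n Vec.∷ pos) (cong suc tot)

compositions : ∀ r n → List (Composition r n)
compositions zero    zero    = mkComposition [] Vec.[] refl ∷ []
compositions zero    (suc n) = []
compositions (suc r) zero    = []
compositions (suc r) (suc n) =
  map prepend-1 (compositions r n) ++ map increment-head (compositions (suc r) n)

parts-injective : ∀ {r n} {u v : Composition r n} → parts u ≡ parts v → u ≡ v
parts-injective {u = mkComposition w p q} {mkComposition .w p′ q′} refl =
  cong₂ (mkComposition w) (Vec.irrelevant ℕ.≤-irrelevant p p′) (ℕ.≡-irrelevant q q′)

compositions-complete : ∀ r n (u : Composition r n) → u ∈ compositions r n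
compositions-complete zero    zero    (mkComposition [] Vec.[] refl) = here refl
compositions-complete (suc r) zero    (mkComposition (zero ∷ v) (() Vec.∷ _) _)
compositions-complete (suc r) (suc n) (mkComposition (1 ∷ v) (_ Vec.∷ pos) tot) =
  subst (_∈ compositions (suc r) (suc n)) (parts-injective refl)
    (∈-++⁺ˡ (∈-map⁺ prepend-1 (compositions-complete r n (mkComposition v pos (ℕ.suc-injective tot)))))
compositions-complete (suc r) (suc n) (mkComposition (suc (suc s) ∷ v) (_ Vec.∷ pos) tot) =
  subst (_∈ compositions (suc r) (suc n)) (parts-injective refl)
    (∈-++⁺ʳ (map prepend-1 (compositions r n)) (∈-map⁺ increment-head
      (compositions-complete (suc r) n
        (mkComposition (suc s ∷ v) (ℕ.s≤s ℕ.z≤n Vec.∷ pos) (ℕ.suc-injective tot)))))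

compositions-unique : ∀ r n → Unique (compositions r n)
compositions-unique zero    zero    = [] AllPairs.∷ AllPairs.[]
compositions-unique zero    (suc n) = AllPairs.[]
compositions-unique (suc r) zero    = AllPairs.[]
compositions-unique (suc r) (suc n) = Unique.++⁺
  (Unique.map⁺ (λ {u} {v} e → parts-injective (Vec.∷-injectiveʳ (cong parts e))) (compositions-unique r n))
  (Unique.map⁺ increment-injective (compositions-unique (suc r) n))
  disjoint
  where
  increment-injective : ∀ {u v : Composition (suc r) n} → increment-head u ≡ increment-head v → u ≡ v
  increment-injective {mkComposition (s ∷ v) (_ Vec.∷ _) _} {mkComposition (s′ ∷ v′) (_ Vec.∷ _) _} e =
    parts-injective (cong₂ _∷_ (ℕ.suc-injective (Vec.∷-injectiveˡ (cong parts e))) (Vec.∷-injectiveʳ (cong parts e)))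
  disjoint : ∀ {u} → (u ∈ map prepend-1 (compositions r n)) × (u ∈ map increment-head (compositions (suc r) n)) → ⊥
  disjoint (p , q) with ∈-map⁻ prepend-1 p | ∈-map⁻ increment-head q
  ... | mkComposition _ _ _ , _ , refl | mkComposition (suc s ∷ v) (ℕ.s≤s _ Vec.∷ _) _ , _ , e with cong parts e
  ...   | ()

-- s₂, …, s_{r-1}, 2b+1+s_r
tailIndex : ℕ → ∀ {r} → Vec ℕ (suc r) → List (ℕ × Sign)
tailIndex b (s ∷ [])     = (2 ℕ.* b ℕ.+ 1 ℕ.+ s , Sign.+) ∷ []
tailIndex b (s ∷ u ∷ v)  = (s , Sign.+) ∷ tailIndex b (u ∷ v)

-- The bar over the first entry is the sign Sign.-.  For r = 1 the only part is s₁ = c+2, so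
-- that the entry below is 2a+2b+4+c.
barIndex : ℕ → ℕ → ∀ {r} → Vec ℕ (suc r) → List (ℕ × Sign)
barIndex a b (s ∷ [])    = (2 ℕ.* a ℕ.+ 2 ℕ.* b ℕ.+ 2 ℕ.+ s , Sign.-) ∷ []
barIndex a b (s ∷ u ∷ v) = (2 ℕ.* a ℕ.+ 1 ℕ.+ s , Sign.-) ∷ tailIndex b (u ∷ v)

tailIndex-positive : ∀ b {r} {v : Vec ℕ (suc r)} → Vec.All (1 ℕ.≤_) v → All (1 ℕ.≤_) (map proj₁ (tailIndex b v))
tailIndex-positive b {v = s ∷ []}    (1≤s Vec.∷ Vec.[]) = ℕ.m≤n⇒m≤o+n (2 ℕ.* b ℕ.+ 1) 1≤s ∷ []
tailIndex-positive b {v = s ∷ u ∷ v} (1≤s Vec.∷ pos)    = 1≤s ∷ tailIndex-positive b pos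

barIndex-admissible : ∀ a b {r} {v : Vec ℕ (suc r)} → Vec.All (1 ℕ.≤_) v → Admissible (map proj₁ (barIndex a b v))
barIndex-admissible a b {v = s ∷ []}    (1≤s Vec.∷ Vec.[]) =
  ℕ.m≤n⇒m≤n+o s (ℕ.m≤n+m 2 (2 ℕ.* a ℕ.+ 2 ℕ.* b)) , []
barIndex-admissible a b {v = s ∷ u ∷ v} (1≤s Vec.∷ pos)    =
  ℕ.+-mono-≤ (ℕ.m≤n+m 1 (2 ℕ.* a)) 1≤s , tailIndex-positive b pos

barIndex-converges : ∀ a b {r n} (u : Composition (suc r) n) → IsCauchy (tSum (barIndex a b (parts u)))
barIndex-converges a b (mkComposition v pos _) = tSum-cauchy (barIndex a b v) (barIndex-admissible a b pos)

starIndex-admissible : ∀ a b c → Admissible (List.replicate a 2 ++ (c ℕ.+ 3) ∷ List.replicate b 2)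
starIndex-admissible zero    b c = ℕ.m≤n⇒m≤o+n c (ℕ.s≤s (ℕ.s≤s ℕ.z≤n)) , All.replicate⁺ b (ℕ.s≤s ℕ.z≤n)
starIndex-admissible (suc a) b c = ℕ.s≤s (ℕ.s≤s ℕ.z≤n) ,
  All.++⁺ (All.replicate⁺ a (ℕ.s≤s ℕ.z≤n))
    (ℕ.m≤n⇒m≤o+n c (ℕ.s≤s ℕ.z≤n) ∷ All.replicate⁺ b (ℕ.s≤s ℕ.z≤n))

{-# OPTIONS --safe #-}

-- Write y_k = 1/(2k-1).  Expanding ∏_{j ≤ n} 1/(1 - y_j² x²) in partial fractions gives weights
-- B_{n,k} with t⋆_n({2}^b) = ∑_k (-1)^{k-1} B_{n,k} y_k^{2b+1}.  Prepending a 2 to the index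
-- multiplies the summand by y_k², and the recurrence of B_{n,k} in k shows that a factor y_n can
-- be moved inside the sum as the operator (S f)_k = y_k f_k + 2 ∑_{j<k} y_j f_j.  Hence
-- t⋆_n({2}^a, c+3, {2}^b) = ∑_k (-1)^{k-1} B_{n,k} y_k^{2a+2} (S^{c+1} y^{2b+1})_k exactly, and
-- expanding S^{c+1} produces the sum over compositions with the powers of 2.  As n → ∞ the sum
-- ∑_k (-1)^{k-1} B_{n,k} f_k is asymptotic to B_{n,1} ∑_k (-1)^{k-1} f_k; the case f = y, where
-- the left side is 1, identifies the limit of B_{n,1} as 4/π without Wallis' product.

module Submission where

open import Defs
open import Data.Nat.Base as ℕ using (ℕ; zero; suc)
import Data.Nat.Properties as ℕ
open import Data.Nat.Solver using () renaming (module +-*-Solver to ℕSolver)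
open import Data.Nat.GeneralisedArithmetic using (fold)
open import Data.Rational.Base hiding (_≃_)
open import Data.Rational.Properties
open import Data.Rational.Solver using (module +-*-Solver)
open import Algebra.Bundles using (CommutativeRing)
open import Algebra.Definitions.RawSemiring +-*-rawSemiring using (_^_)
open import Algebra.Properties.Semiring.Exp (CommutativeRing.semiring +-*-commutativeRing) using (^-homo-*)
open import Data.Product.Base using (∃; _,_; proj₁; proj₂)
open import Data.List.Base using (List; []; _∷_; _++_; foldr; map; replicate; upTo; applyUpTo)
open import Data.List.Properties using (++-identityʳ)
open import Data.Vec.Base using (Vec; []; _∷_)
import Data.Vec.Relation.Unary.All as Vec
open import Function.Base using (_∘_; id)
open import Relation.Binary.PropositionalEquality
open import Relation.Nullary.Decidable using (toWitness)

open +-*-Solver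

-- Cancellation, finite sums and order in the rationals.

*-cancelˡ-≢0 : ∀ {s p q} → s ≢ 0ℚ → s * p ≡ s * q → p ≡ q
*-cancelˡ-≢0 {s} {p} {q} s≢0 eq = trans (unscale p) (trans (cong (recip s *_) eq) (sym (unscale q)))
  where
  unscale : ∀ x → x ≡ recip s * (s * x)
  unscale x = trans (sym (*-identityˡ x)) (trans (cong (_* x) (sym (recip-inverse s≢0)))
    (solve 3 (λ s r x → s :* r :* x := r :* (s :* x)) refl s (recip s) x))

0<⇒≢0 : ∀ {p} → 0ℚ < p → p ≢ 0ℚ
0<⇒≢0 0<p p≡0 = <⇒≢ 0<p (sym p≡0)

partialSum : (ℕ → ℚ) → ℕ → ℚ
partialSum f zero    = 0ℚ
partialSum f (suc n) = partialSum f n + f n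

partialSum-cong : ∀ {f g} → (∀ k → f k ≡ g k) → ∀ n → partialSum f n ≡ partialSum g n
partialSum-cong f≡g zero    = refl
partialSum-cong f≡g (suc n) = cong₂ _+_ (partialSum-cong f≡g n) (f≡g n)

partialSum-+ : ∀ f g n → partialSum (λ k → f k + g k) n ≡ partialSum f n + partialSum g n
partialSum-+ f g zero    = refl
partialSum-+ f g (suc n) = trans (cong (_+ (f n + g n)) (partialSum-+ f g n))
  (solve 4 (λ a b c d → (a :+ b) :+ (c :+ d) := (a :+ c) :+ (b :+ d)) refl
    (partialSum f n) (partialSum g n) (f n) (g n))

partialSum-* : ∀ c f n → partialSum (λ k → c * f k) n ≡ c * partialSum f n
partialSum-* c f zero    = sym (*-zeroʳ c)
partialSum-* c f (suc n) = trans (cong (_+ c * f n) (partialSum-* c f n))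
  (sym (*-distribˡ-+ c (partialSum f n) (f n)))

partialSum-zero : ∀ n → partialSum (λ _ → 0ℚ) n ≡ 0ℚ
partialSum-zero zero    = refl
partialSum-zero (suc n) = trans (+-identityʳ _) (partialSum-zero n)

partialSum-head : ∀ f n → partialSum f (suc n) ≡ f 0 + partialSum (f ∘ suc) n
partialSum-head f zero    = +-comm 0ℚ (f 0)
partialSum-head f (suc n) = trans (cong (_+ f (suc n)) (partialSum-head f n))
  (+-assoc (f 0) (partialSum (f ∘ suc) n) (f (suc n)))

partialSum-swap : ∀ (f : ℕ → ℕ → ℚ) m n →
  partialSum (λ i → partialSum (f i) n) m ≡ partialSum (λ j → partialSum (λ i → f i j) m) n
partialSum-swap f zero    n = sym (partialSum-zero n)
partialSum-swap f (suc m) n = trans (cong (_+ partialSum (f m) n) (partialSum-swap f m n))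
  (sym (partialSum-+ (λ j → partialSum (λ i → f i j) m) (f m) n))

partialSum-split : ∀ f m j → partialSum f (j ℕ.+ m) ≡ partialSum f m + partialSum (λ i → f (i ℕ.+ m)) j
partialSum-split f m zero    = sym (+-identityʳ (partialSum f m))
partialSum-split f m (suc j) = trans (cong (_+ f (j ℕ.+ m)) (partialSum-split f m j))
  (+-assoc (partialSum f m) _ _)

partialSum-telescope : ∀ {f} (u : ℕ → ℚ) → (∀ k → f k ≡ u k - u (suc k)) → ∀ n → partialSum f n ≡ u 0 - u n
partialSum-telescope u step zero    = sym (+-inverseʳ (u 0))
partialSum-telescope u step (suc n) = trans (cong₂ _+_ (partialSum-telescope u step n) (step n))
  (solve 3 (λ a b c → (a :- b) :+ (b :- c) := a :- c) refl (u 0) (u n) (u (suc n)))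

partialSum-mono : ∀ {f g} n → (∀ k → k ℕ.< n → f k ≤ g k) → partialSum f n ≤ partialSum g n
partialSum-mono zero    f≤g = ≤-refl
partialSum-mono (suc n) f≤g =
  +-mono-≤ (partialSum-mono n λ k k<n → f≤g k (ℕ.m≤n⇒m≤1+n k<n)) (f≤g n ℕ.≤-refl)

∣partialSum∣≤ : ∀ f n → ∣ partialSum f n ∣ ≤ partialSum (λ k → ∣ f k ∣) n
∣partialSum∣≤ f zero    = ≤-refl
∣partialSum∣≤ f (suc n) = ≤-trans (∣p+q∣≤∣p∣+∣q∣ (partialSum f n) (f n))
  (+-monoˡ-≤ ∣ f n ∣ (∣partialSum∣≤ f n))

0<odd : ∀ n → 0ℚ < odd n
0<odd n = 0<fromℕ (2 ℕ.* n)

odd-mono : ∀ {k n} → k ℕ.≤ n → odd k ≤ odd n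
odd-mono {k} {n} k≤n = subst (λ m → odd k ≤ odd m) (ℕ.m∸n+n≡m k≤n) (go (n ℕ.∸ k))
  where
  go : ∀ j → odd k ≤ odd (j ℕ.+ k)
  go zero    = ≤-refl
  go (suc j) = ≤-trans (go j) (subst (odd (j ℕ.+ k) ≤_)
    (trans (+-comm (odd (j ℕ.+ k)) 2ℚ) (sym (odd-suc (j ℕ.+ k)))) (≤-+ʳ (<⇒≤ 0<2)))

recipOdd-mono : ∀ {k n} → k ℕ.≤ n → recipOdd n ≤ recipOdd k
recipOdd-mono {k} {n} k≤n = subst (λ m → recipOdd m ≤ recipOdd k) (ℕ.m∸n+n≡m k≤n) (go (n ℕ.∸ k))
  where
  go : ∀ j → recipOdd (j ℕ.+ k) ≤ recipOdd k
  go zero    = ≤-refl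
  go (suc j) = ≤-trans (recipOdd-antitone (j ℕ.+ k)) (go j)

recipOdd-suc<1 : ∀ n → recipOdd (suc n) < 1ℚ
recipOdd-suc<1 n = ≤-<-trans (recipOdd-mono {1} {suc n} (ℕ.s≤s ℕ.z≤n)) (toWitness {a? = recipOdd 1 <? 1ℚ} _)

<⇒0<- : ∀ {p q} → p < q → 0ℚ < q - p
<⇒0<- {p} {q} p<q = subst (_< q - p) (+-inverseʳ p) (+-monoˡ-< (- p) p<q)

-- The partial-fraction weights and their recurrences.

altSign : ℕ → ℚ
altSign k = (- 1ℚ) ^ k

-- Keeps the `recip` in `weight₀` off its default value at 0.
0<1-recipOdd² : ∀ n → 0ℚ < 1ℚ - recipOdd (suc n) * recipOdd (suc n)
0<1-recipOdd² n = <⇒0<- (≤-<-trans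
  (subst (y * y ≤_) (*-identityʳ y) (*-monoˡ (0≤recipOdd (suc n)) (recipOdd≤1 (suc n))))
  (recipOdd-suc<1 n))
  where y = recipOdd (suc n)

-- weight (n - 1) (k - 1) is ((2n-1)‼)² / (4ⁿ⁻¹ (n-k)! (n+k-1)!), which is up to the factor
-- (-1)ᵏ⁻¹ / (2k-1) the coefficient of 1 / (1 - x²/(2k-1)²) in the partial fraction expansion
-- of ∏_{j ≤ n} 1 / (1 - x²/(2j-1)²).
weight₀ : ℕ → ℚ
weight₀ zero    = 1ℚ
weight₀ (suc n) = weight₀ n * recip (1ℚ - recipOdd (suc n) * recipOdd (suc n))

weight : ℕ → ℕ → ℚ
weight n zero    = weight₀ n
weight n (suc k) = weight n k * ((odd n - odd k) * recip (odd n + odd (suc k)))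

0<odd+odd : ∀ n k → 0ℚ < odd n + odd k
0<odd+odd n k = 0<+ (<⇒≤ (0<odd n)) (0<odd k)

-- The ratio of neighbouring weights with its denominator cleared, the form in which `altSum-shift`
-- telescopes.
weight-col : ∀ n k → (odd n + odd (suc k)) * weight n (suc k) ≡ (odd n - odd k) * weight n k
weight-col n k = trans
  (solve 4 (λ s w d r → s :* (w :* (d :* r)) := (s :* r) :* (d :* w)) refl
    s (weight n k) (odd n - odd k) (recip s))
  (trans (cong (_* ((odd n - odd k) * weight n k)) (recip-inverse (0<⇒≢0 (0<odd+odd n (suc k)))))
    (*-identityˡ _))
  where s = odd n + odd (suc k)

-- The factor `odd n - odd n` ends the row at `k = n`, so boundary terms at `suc n` drop out of
-- every later summation.
weight-last : ∀ n → weight n (suc n) ≡ 0ℚ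
weight-last n = trans (cong (λ d → weight n n * (d * recip (odd n + odd (suc n)))) (+-inverseʳ (odd n)))
  (solve 2 (λ w r → w :* (con 0ℚ :* r) := con 0ℚ) refl (weight n n) (recip (odd n + odd (suc n))))

-- A further factor 1/(1 - x² y²) of the product multiplies the coefficient at the pole x = `odd k`
-- by its value there. The relation is multiplied out because the bracket is 0 at `k = suc n`. The
-- proof is by induction along `k`, with `weight-col` in both rows.
weight-row : ∀ n k →
  weight n k ≡ weight (suc n) k * (1ℚ - (odd k * recipOdd (suc n)) * (odd k * recipOdd (suc n)))
weight-row n zero = sym (begin
  weight₀ n * recip u * (1ℚ - (odd 0 * y) * (odd 0 * y))   ≡⟨ cong (λ z → weight₀ n * recip u * (1ℚ - z * z)) (*-identityˡ y) ⟩
  weight₀ n * recip u * u                        ≡⟨ solve 3 (λ w r u → w :* r :* u := w :* (u :* r)) refl (weight₀ n) (recip u) u ⟩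
  weight₀ n * (u * recip u)                      ≡⟨ cong (weight₀ n *_) (recip-inverse (0<⇒≢0 (0<1-recipOdd² n))) ⟩
  weight₀ n * 1ℚ                                 ≡⟨ *-identityʳ (weight₀ n) ⟩
  weight₀ n                                      ∎)
  where
  open ≡-Reasoning
  y = recipOdd (suc n)
  u = 1ℚ - y * y
weight-row n (suc k) = *-cancelˡ-≢0 (0<⇒≢0 (0<odd+odd n (suc k))) (begin
  (o + odd (suc k)) * weight n (suc k)           ≡⟨ weight-col n k ⟩
  (o - p) * weight n k                           ≡⟨ cong ((o - p) *_) (weight-row n k) ⟩
  -- Writing 1 as the square of `y * (2ℚ + o)` gives a difference of squares, which supplies the
  -- factor `(2ℚ + o) - p` of the column recurrence in row `suc n`.
  (o - p) * (v * (1ℚ - (p * y) * (p * y)))       ≡⟨ cong (λ z → (o - p) * (v * (z * z - (p * y) * (p * y)))) yo ⟨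
  (o - p) * (v * ((y * (2ℚ + o)) * (y * (2ℚ + o)) - (p * y) * (p * y)))
    ≡⟨ solve 5 (λ o p v y t → (o :- p) :* (v :* ((y :* (t :+ o)) :* (y :* (t :+ o)) :- (p :* y) :* (p :* y)))
         := (o :- p) :* (t :+ o :+ p) :* y :* y :* (((t :+ o) :- p) :* v)) refl o p v y 2ℚ ⟩
  (o - p) * (2ℚ + o + p) * y * y * (((2ℚ + o) - p) * v)   ≡⟨ cong ((o - p) * (2ℚ + o + p) * y * y *_) col ⟩
  (o - p) * (2ℚ + o + p) * y * y * (((2ℚ + o) + (2ℚ + p)) * v′)
    ≡⟨ solve 5 (λ o p v y t → (o :- p) :* (t :+ o :+ p) :* y :* y :* (((t :+ o) :+ (t :+ p)) :* v)
         := (o :+ (t :+ p)) :* (v :* ((y :* (t :+ o)) :* (y :* (t :+ o)) :- ((t :+ p) :* y) :* ((t :+ p) :* y)))) refl o p v′ y 2ℚ ⟩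
  (o + (2ℚ + p)) * (v′ * ((y * (2ℚ + o)) * (y * (2ℚ + o)) - ((2ℚ + p) * y) * ((2ℚ + p) * y)))
    ≡⟨ cong (λ z → (o + (2ℚ + p)) * (v′ * (z * z - ((2ℚ + p) * y) * ((2ℚ + p) * y)))) yo ⟩
  (o + (2ℚ + p)) * (v′ * (1ℚ - ((2ℚ + p) * y) * ((2ℚ + p) * y)))
    ≡⟨ cong (λ z → (o + z) * (v′ * (1ℚ - (z * y) * (z * y)))) (odd-suc k) ⟨
  (o + odd (suc k)) * (v′ * (1ℚ - (odd (suc k) * y) * (odd (suc k) * y)))   ∎)
  where
  open ≡-Reasoning
  o  = odd n
  p  = odd k
  y  = recipOdd (suc n)
  v  = weight (suc n) k
  v′ = weight (suc n) (suc k)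
  yo : y * (2ℚ + o) ≡ 1ℚ
  yo = trans (cong (y *_) (sym (odd-suc n))) (recipOdd*odd (suc n))
  col : ((2ℚ + o) - p) * v ≡ ((2ℚ + o) + (2ℚ + p)) * v′
  col = begin
    ((2ℚ + o) - p) * v               ≡⟨ cong (λ z → (z - p) * v) (odd-suc n) ⟨
    (odd (suc n) - p) * v            ≡⟨ weight-col (suc n) k ⟨
    (odd (suc n) + odd (suc k)) * v′ ≡⟨ cong₂ (λ a b → (a + b) * v′) (odd-suc n) (odd-suc k) ⟩
    ((2ℚ + o) + (2ℚ + p)) * v′       ∎

-- Alternating weighted sums and the operator `shift`.

altSum : ℕ → (ℕ → ℚ) → ℚ
altSum n f = partialSum (λ k → altSign k * weight n k * f k) (suc n)

altSum-cong : ∀ n {f g} → (∀ k → f k ≡ g k) → altSum n f ≡ altSum n g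
altSum-cong n f≡g = partialSum-cong (λ k → cong (altSign k * weight n k *_) (f≡g k)) (suc n)

-- The operator S. Its two consecutive partial sums pair with the factors `odd n - odd k` and
-- `odd n + odd k` of `weight-col`.
shift : (ℕ → ℚ) → ℕ → ℚ
shift f k = d (suc k) + d k
  where d = partialSum (λ j → recipOdd j * f j)

-- By `weight-col`, `odd n * X - Y` telescopes along `u`. Both ends vanish: `d 0` is 0, and so is
-- `weight n (suc n)`.
altSum-shift : ∀ n f → altSum n (shift f) ≡ recipOdd n * altSum n f
altSum-shift n f = begin
  X                             ≡⟨ *-identityˡ X ⟨
  1ℚ * X                        ≡⟨ cong (_* X) (recipOdd*odd n) ⟨
  recipOdd n * odd n * X        ≡⟨ solve 4 (λ y o x e → y :* o :* x := y :* ((o :* x :+ (:- con 1ℚ) :* e) :+ e)) refl (recipOdd n) (odd n) X Y ⟩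
  recipOdd n * ((odd n * X + (- 1ℚ) * Y) + Y)  ≡⟨ cong (λ z → recipOdd n * (z + Y)) vanishes ⟩
  recipOdd n * (0ℚ + Y)         ≡⟨ cong (recipOdd n *_) (+-identityˡ Y) ⟩
  recipOdd n * Y                ∎
  where
  open ≡-Reasoning
  X = altSum n (shift f)
  Y = altSum n f
  d : ℕ → ℚ
  d = partialSum (λ j → recipOdd j * f j)
  u : ℕ → ℚ
  u k = altSign k * ((odd n + odd k) * weight n k * d k)
  step : ∀ k → odd n * (altSign k * weight n k * shift f k) + (- 1ℚ) * (altSign k * weight n k * f k)
             ≡ u k - u (suc k)
  step k = begin
    o * (e * w * ((c + g) + c)) + (- 1ℚ) * (e * w * f k)   ≡⟨ cong (λ z → o * (e * w * ((c + g) + c)) + (- 1ℚ) * (e * w * z)) fk ⟩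
    o * (e * w * ((c + g) + c)) + (- 1ℚ) * (e * w * (p * g))
      ≡⟨ solve 6 (λ o e w c g p → o :* (e :* w :* ((c :+ g) :+ c)) :+ (:- con 1ℚ) :* (e :* w :* (p :* g))
           := e :* ((o :+ p) :* w :* c) :- ((:- con 1ℚ) :* e) :* (((o :- p) :* w) :* (c :+ g))) refl o e w c g p ⟩
    u k - (- 1ℚ * e) * (((o - p) * w) * (c + g))   ≡⟨ cong (λ z → u k - (- 1ℚ * e) * (z * (c + g))) (weight-col n k) ⟨
    u k - u (suc k)   ∎
    where
    o = odd n
    e = altSign k
    w = weight n k
    c = d k
    g = recipOdd k * f k
    p = odd k
    fk : f k ≡ p * g
    fk = trans (sym (*-identityˡ (f k))) (trans (cong (_* f k) (sym (recipOdd*odd k)))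
      (solve 3 (λ y o f → y :* o :* f := o :* (y :* f)) refl (recipOdd k) p (f k)))
  vanishes : odd n * X + (- 1ℚ) * Y ≡ 0ℚ
  vanishes = begin
    odd n * X + (- 1ℚ) * Y
      ≡⟨ cong₂ _+_ (partialSum-* (odd n) (λ k → altSign k * weight n k * shift f k) (suc n)) (partialSum-* (- 1ℚ) (λ k → altSign k * weight n k * f k) (suc n)) ⟨
    _ ≡⟨ partialSum-+ _ _ (suc n) ⟨
    _ ≡⟨ partialSum-telescope u step (suc n) ⟩
    u 0 - u (suc n)
      ≡⟨ cong (λ z → u 0 - altSign (suc n) * ((odd n + odd (suc n)) * z * d (suc n))) (weight-last n) ⟩
    u 0 - altSign (suc n) * ((odd n + odd (suc n)) * 0ℚ * d (suc n))
      ≡⟨ solve 6 (λ e s w e′ c d → e :* (s :* w :* con 0ℚ) :- e′ :* (c :* con 0ℚ :* d) := con 0ℚ) refl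
           1ℚ (odd n + odd 0) (weight n 0) (altSign (suc n)) (odd n + odd (suc n)) (d (suc n)) ⟩
    0ℚ ∎

altSum-extend : ∀ n f → partialSum (λ k → altSign k * weight n k * f k) (suc (suc n)) ≡ altSum n f
altSum-extend n f = trans (cong (λ w → altSum n f + altSign (suc n) * w * f (suc n)) (weight-last n))
  (solve 3 (λ a e x → a :+ e :* con 0ℚ :* x := a) refl (altSum n f) (altSign (suc n)) (f (suc n)))

-- By `weight-row`, the weights of rows `n` and `suc n` differ by the square of
-- `odd k * recipOdd (suc n)` times the new weight, and the square of `odd k` cancels the square of
-- `recipOdd k` in `f`.
altSum-suc : ∀ n h → let f = λ k → recipOdd k * recipOdd k * h k in
  altSum (suc n) f ≡ altSum n f + recipOdd (suc n) * recipOdd (suc n) * altSum (suc n) h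
altSum-suc n h = begin
  altSum (suc n) f                     ≡⟨ partialSum-cong term (suc (suc n)) ⟩
  partialSum (λ k → altSign k * weight n k * f k + y * y * (altSign k * weight (suc n) k * h k)) (suc (suc n))
    ≡⟨ partialSum-+ _ _ (suc (suc n)) ⟩
  _ ≡⟨ cong₂ _+_ (altSum-extend n f) (partialSum-* (y * y) (λ k → altSign k * weight (suc n) k * h k) (suc (suc n))) ⟩
  altSum n f + y * y * altSum (suc n) h   ∎
  where
  open ≡-Reasoning
  y = recipOdd (suc n)
  f : ℕ → ℚ
  f k = recipOdd k * recipOdd k * h k
  term : ∀ k → altSign k * weight (suc n) k * f k
             ≡ altSign k * weight n k * f k + y * y * (altSign k * weight (suc n) k * h k)
  term k = sym (begin
    e * weight n k * (x * x * h k) + y * y * (e * w * h k)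
      ≡⟨ cong (λ z → e * z * (x * x * h k) + y * y * (e * w * h k)) (weight-row n k) ⟩
    e * (w * (1ℚ - (o * y) * (o * y))) * (x * x * h k) + y * y * (e * w * h k)
      ≡⟨ solve 6 (λ e w o y x h → e :* (w :* (con 1ℚ :- (o :* y) :* (o :* y))) :* (x :* x :* h) :+ y :* y :* (e :* w :* h)
           := e :* w :* (x :* x :* h) :+ y :* y :* (e :* w :* h) :* (con 1ℚ :- (x :* o) :* (x :* o))) refl e w o y x (h k) ⟩
    e * w * (x * x * h k) + y * y * (e * w * h k) * (1ℚ - (x * o) * (x * o))
      ≡⟨ cong (λ z → e * w * (x * x * h k) + y * y * (e * w * h k) * (1ℚ - z * z)) (recipOdd*odd k) ⟩
    e * w * (x * x * h k) + y * y * (e * w * h k) * (1ℚ - 1ℚ * 1ℚ)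
      ≡⟨ solve 2 (λ a b → a :+ b :* (con 1ℚ :- con 1ℚ :* con 1ℚ) := a) refl (e * w * (x * x * h k)) (y * y * (e * w * h k)) ⟩
    e * w * (x * x * h k) ∎)
    where
    e = altSign k
    w = weight (suc n) k
    o = odd k
    x = recipOdd k

-- Every `recipOdd j * odd j` is 1, so the two partial sums count to `suc k` and to `k`.
shift-odd : ∀ k → shift odd k ≡ odd k
shift-odd zero    = refl
shift-odd (suc k) = begin
  ((d + a) + b) + (d + a)      ≡⟨ solve 3 (λ d a b → ((d :+ a) :+ b) :+ (d :+ a) := (b :+ a) :+ ((d :+ a) :+ d)) refl d a b ⟩
  (b + a) + ((d + a) + d)      ≡⟨ cong₂ _+_ (cong₂ _+_ (recipOdd*odd (suc k)) (recipOdd*odd k)) (shift-odd k) ⟩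
  2ℚ + odd k                   ≡⟨ odd-suc k ⟨
  odd (suc k)                  ∎
  where
  open ≡-Reasoning
  d = partialSum (λ j → recipOdd j * odd j) k
  a = recipOdd k * odd k
  b = recipOdd (suc k) * odd (suc k)

-- Since `shift` fixes `odd`, the sum equals itself times `recipOdd (suc n)`, which is less than 1.
-- In row 0 that factor is 1 and the sum is 1.
altSum-odd : ∀ n → altSum (suc n) odd ≡ 0ℚ
altSum-odd n = *-cancelˡ-≢0 (0<⇒≢0 (<⇒0<- (recipOdd-suc<1 n))) (begin
  (1ℚ - y) * x      ≡⟨ solve 2 (λ y x → (con 1ℚ :- y) :* x := x :- y :* x) refl y x ⟩
  x - y * x         ≡⟨ cong (λ z → x - z) (altSum-shift (suc n) odd) ⟨
  x - altSum (suc n) (shift odd)   ≡⟨ cong (λ z → x - z) (altSum-cong (suc n) shift-odd) ⟩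
  x - x             ≡⟨ +-inverseʳ x ⟩
  0ℚ                ≡⟨ *-zeroʳ (1ℚ - y) ⟨
  (1ℚ - y) * 0ℚ     ∎)
  where
  open ≡-Reasoning
  y = recipOdd (suc n)
  x = altSum (suc n) odd

-- In `altSum-suc` with `h = odd` the increment is 0, so the value 1 of row 0 persists. This
-- represents the empty index, and later it calibrates `weight₀`.
altSum-recipOdd : ∀ n → altSum n recipOdd ≡ 1ℚ
altSum-recipOdd n = trans (altSum-cong n y≡y²o) (go n)
  where
  y≡y²o : ∀ k → recipOdd k ≡ recipOdd k * recipOdd k * odd k
  y≡y²o k = trans (sym (*-identityʳ (recipOdd k))) (trans (cong (recipOdd k *_) (sym (recipOdd*odd k)))
    (sym (*-assoc (recipOdd k) (recipOdd k) (odd k))))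
  go : ∀ n → altSum n (λ k → recipOdd k * recipOdd k * odd k) ≡ 1ℚ
  go zero    = refl
  go (suc n) = trans (altSum-suc n odd) (trans
    (cong₂ _+_ (go n) (trans (cong (recipOdd (suc n) * recipOdd (suc n) *_) (altSum-odd n)) (*-zeroʳ (recipOdd (suc n) * recipOdd (suc n)))))
    (+-identityʳ 1ℚ))

altSum-fold-shift : ∀ n f m → altSum n (fold f shift m) ≡ recipOdd n ^ m * altSum n f
altSum-fold-shift n f zero    = sym (*-identityˡ (altSum n f))
altSum-fold-shift n f (suc m) = trans (altSum-shift n (fold f shift m))
  (trans (cong (recipOdd n *_) (altSum-fold-shift n f m))
    (sym (*-assoc (recipOdd n) (recipOdd n ^ m) (altSum n f))))

-- Truncated t⋆ sums as alternating weighted sums.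

-- Of the `2 + m` factors `recipOdd n` in the new term, `m` enter the sum as shifts and two feed
-- `altSum-suc`. Rows count from 0, so row `n` belongs to the truncation at `suc n`.
t⋆Sum-cons : ∀ {w f} m → (∀ n → t⋆Sum w (suc n) ≡ altSum n f) →
  ∀ n → t⋆Sum (2 ℕ.+ m ∷ w) (suc n) ≡ altSum n (λ k → recipOdd k * recipOdd k * fold f shift m k)
t⋆Sum-cons {w} {f} m ih = go
  where
  open ≡-Reasoning
  h : ℕ → ℚ
  h = fold f shift m
  term : ∀ n → recipOdd n ^ (2 ℕ.+ m) * t⋆Sum w (suc n) ≡ recipOdd n * recipOdd n * altSum n h
  term n = begin
    y * (y * y ^ m) * t⋆Sum w (suc n)     ≡⟨ cong (y * (y * y ^ m) *_) (ih n) ⟩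
    y * (y * y ^ m) * altSum n f          ≡⟨ solve 3 (λ y p x → y :* (y :* p) :* x := y :* y :* (p :* x)) refl y (y ^ m) (altSum n f) ⟩
    y * y * (y ^ m * altSum n f)          ≡⟨ cong (y * y *_) (altSum-fold-shift n f m) ⟨
    y * y * altSum n h                    ∎
    where y = recipOdd n
  go : ∀ n → t⋆Sum (2 ℕ.+ m ∷ w) (suc n) ≡ altSum n (λ k → recipOdd k * recipOdd k * h k)
  go zero    = trans (cong (0ℚ +_) (term 0))
    -- In row 0 the sign, the weight and `recipOdd 0` all compute to 1.
    (solve 1 (λ x → con 0ℚ :+ con 1ℚ :* con 1ℚ :* (con 0ℚ :+ con 1ℚ :* con 1ℚ :* x) := con 0ℚ :+ con 1ℚ :* con 1ℚ :* (con 1ℚ :* con 1ℚ :* x)) refl (h 0))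
  go (suc n) = trans (cong₂ _+_ (go n) (term (suc n))) (sym (altSum-suc n h))

t⋆Sum-2s : ∀ {w f} → (∀ n → t⋆Sum w (suc n) ≡ altSum n f) → ∀ a n →
  t⋆Sum (replicate a 2 ++ w) (suc n) ≡ altSum n (λ k → recipOdd k ^ (2 ℕ.* a) * f k)
t⋆Sum-2s {f = f} ih zero    n = trans (ih n) (altSum-cong n λ k → sym (*-identityˡ (f k)))
t⋆Sum-2s {f = f} ih (suc a) n = trans (t⋆Sum-cons 0 (t⋆Sum-2s ih a) n) (altSum-cong n λ k →
  trans (solve 3 (λ y p x → y :* y :* (p :* x) := y :* (y :* p) :* x) refl (recipOdd k) (recipOdd k ^ (2 ℕ.* a)) (f k))
    (cong (λ j → recipOdd k ^ j * f k) (sym (ℕ.*-suc 2 a))))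

-- Read from the inside: `b` twos applied to `recipOdd`, then the entry c+3 = 2 + (c+1) with its
-- `suc c` shifts, then `a` twos.
summand : ℕ → ℕ → ℕ → ℕ → ℚ
summand a b c k = recipOdd k ^ (2 ℕ.* a) *
  (recipOdd k * recipOdd k * fold (λ j → recipOdd j ^ (2 ℕ.* b) * recipOdd j) shift (suc c) k)

t⋆Sum≡altSum : ∀ a b c n →
  t⋆Sum (replicate a 2 ++ (c ℕ.+ 3) ∷ replicate b 2) (suc n) ≡ altSum n (summand a b c)
t⋆Sum≡altSum a b c = t⋆Sum-2s (λ n → trans
  (cong (λ s → t⋆Sum (s ∷ replicate b 2) (suc n)) (ℕ.+-comm c 3))
  (t⋆Sum-cons (suc c) twos n)) a
  where
  twos : ∀ n → t⋆Sum (replicate b 2) (suc n) ≡ altSum n (λ j → recipOdd j ^ (2 ℕ.* b) * recipOdd j)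
  twos n = trans (cong (λ w → t⋆Sum w (suc n)) (sym (++-identityʳ (replicate b 2))))
    (t⋆Sum-2s (λ n → sym (altSum-recipOdd n)) b n)

-- Positivity and monotonicity of the weights.

0≤weight₀ : ∀ n → 0ℚ ≤ weight₀ n
0≤weight₀ zero    = 0≤1
0≤weight₀ (suc n) = 0≤* (0≤weight₀ n) (<⇒≤ (0<recip (0<1-recipOdd² n)))

0≤weight : ∀ n k → k ℕ.≤ suc n → 0ℚ ≤ weight n k
0≤weight n zero    _           = 0≤weight₀ n
0≤weight n (suc k) (ℕ.s≤s k≤n) = 0≤* (0≤weight n k (ℕ.m≤n⇒m≤1+n k≤n))
  (0≤* (≤⇒0≤- (odd-mono k≤n)) (<⇒≤ (0<recip (0<odd+odd n (suc k)))))

weightDrop : ℕ → ℕ → ℚ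
weightDrop n k = weight n k - weight n (suc k)

-- A rearrangement of `weight-col` that exhibits two facts at once: the drop is nonnegative, and it
-- carries a factor `recipOdd n`.
weightDrop≡ : ∀ n k → weightDrop n k ≡ recipOdd n * (odd k * weight n k + odd (suc k) * weight n (suc k))
weightDrop≡ n k = begin
  w - v                     ≡⟨ *-identityˡ (w - v) ⟨
  1ℚ * (w - v)              ≡⟨ cong (_* (w - v)) (recipOdd*odd n) ⟨
  y * o * (w - v)           ≡⟨ solve 6 (λ y o p q w v → y :* o :* (w :- v)
                                 := y :* ((o :- p) :* w :+ p :* w :- o :* v)) refl y o p q w v ⟩
  y * ((o - p) * w + p * w - o * v)         ≡⟨ cong (λ z → y * (z + p * w - o * v)) (weight-col n k) ⟨
  y * ((o + q) * v + p * w - o * v)         ≡⟨ solve 6 (λ y o p q w v → y :* ((o :+ q) :* v :+ p :* w :- o :* v)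
                                                 := y :* (p :* w :+ q :* v)) refl y o p q w v ⟩
  y * (p * w + q * v)       ∎
  where
  open ≡-Reasoning
  y = recipOdd n
  o = odd n
  p = odd k
  q = odd (suc k)
  w = weight n k
  v = weight n (suc k)

0≤weightDrop : ∀ n k → k ℕ.≤ n → 0ℚ ≤ weightDrop n k
0≤weightDrop n k k≤n = subst (0ℚ ≤_) (sym (weightDrop≡ n k)) (0≤* (0≤recipOdd n) (0≤+
  (0≤* (<⇒≤ (0<odd k)) (0≤weight n k (ℕ.m≤n⇒m≤1+n k≤n)))
  (0≤* (<⇒≤ (0<odd (suc k))) (0≤weight n (suc k) (ℕ.s≤s k≤n)))))

weight≤weight₀ : ∀ n k → k ℕ.≤ suc n → weight n k ≤ weight₀ n
weight≤weight₀ n zero    _           = ≤-refl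
weight≤weight₀ n (suc k) (ℕ.s≤s k≤n) =
  ≤-trans (0≤-⇒≤ (0≤weightDrop n k k≤n)) (weight≤weight₀ n k (ℕ.m≤n⇒m≤1+n k≤n))

-- Summation by parts and the bound on `weight₀`.

-- A characterisation by recurrence, so that `leibnizSum` and the underlying sequence of a real both
-- qualify as they stand.
record IsAltSeries (f C : ℕ → ℚ) : Set where
  constructor mkAltSeries
  field
    at-zero : C 0 ≡ 0ℚ
    at-suc  : ∀ k → C (suc k) ≡ C k + altSign k * f k

-- Abel summation centred at an arbitrary `c`: the drops of a row add up to `weight₀ n`, which
-- accounts for the main term, and `weight-last` kills the boundary term. It is used with `c = ½`
-- for a bound and with `c = C (suc n)` for the limit.
altSum-byParts : ∀ {f C} → IsAltSeries f C → ∀ n c →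
  altSum n f ≡ c * weight₀ n + partialSum (λ k → (C (suc k) - c) * weightDrop n k) (suc n)
altSum-byParts {f} {C} (mkAltSeries C0 Csuc) n c = trans (go (suc n)) (trans
  (cong (λ w → (C (suc n) - c) * w + c * weight₀ n + S (suc n)) (weight-last n))
  (solve 3 (λ a b s → a :* con 0ℚ :+ b :+ s := b :+ s) refl (C (suc n) - c) (c * weight₀ n) (S (suc n))))
  where
  open ≡-Reasoning
  S : ℕ → ℚ
  S = partialSum (λ k → (C (suc k) - c) * weightDrop n k)
  go : ∀ j → partialSum (λ k → altSign k * weight n k * f k) j ≡ (C j - c) * weight n j + c * weight₀ n + S j
  go zero    = sym (trans (cong (λ z → (z - c) * weight₀ n + c * weight₀ n + 0ℚ) C0)
    (solve 2 (λ c w → (con 0ℚ :- c) :* w :+ c :* w :+ con 0ℚ := con 0ℚ) refl c (weight₀ n)))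
  go (suc j) = begin
    partialSum (λ k → altSign k * weight n k * f k) j + e * w * f j   ≡⟨ cong (_+ e * w * f j) (go j) ⟩
    (C j - c) * w + c * w₀ + S j + e * w * f j
      ≡⟨ solve 8 (λ x c w w₀ s e f v → (x :- c) :* w :+ c :* w₀ :+ s :+ e :* w :* f
           := ((x :+ e :* f) :- c) :* v :+ c :* w₀ :+ (s :+ ((x :+ e :* f) :- c) :* (w :- v))) refl (C j) c w w₀ (S j) e (f j) v ⟩
    ((C j + e * f j) - c) * v + c * w₀ + (S j + ((C j + e * f j) - c) * (w - v))
      ≡⟨ cong (λ z → (z - c) * v + c * w₀ + (S j + (z - c) * (w - v))) (Csuc j) ⟨
    (C (suc j) - c) * v + c * w₀ + (S j + (C (suc j) - c) * (w - v)) ∎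
    where
    e  = altSign j
    w  = weight n j
    v  = weight n (suc j)
    w₀ = weight₀ n

leibniz-isAltSeries : IsAltSeries recipOdd leibnizSum
leibniz-isAltSeries = mkAltSeries refl λ _ → refl

-- After the leading 1 the alternating tail removes at most 1/3. The bound also keeps the
-- approximations of π away from 0.
½≤leibniz : ∀ k → ½ ≤ leibnizSum (suc k)
½≤leibniz k = subst (λ j → ½ ≤ leibnizSum j) (ℕ.+-comm k 1) (begin
  ½                                   ≤⟨ toWitness {a? = ½ ≤? 1ℚ - recipOdd 1} _ ⟩
  1ℚ - recipOdd 1                     ≤⟨ +-monoʳ-≤ 1ℚ (neg-antimono-≤ (proj₂ (altTail-bounds 1 k))) ⟩
  1ℚ - altTail 1 k                    ≡⟨ solve 1 (λ x → con 1ℚ :- x := con 1ℚ :+ (:- con 1ℚ) :* x) refl (altTail 1 k) ⟩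
  1ℚ + (- 1ℚ) * altTail 1 k           ≡⟨ leibniz-tail 1 k ⟨
  leibnizSum (k ℕ.+ 1)                ∎)
  where open ≤-Reasoning

-- Summing `recipOdd` by parts around ½ gives 1 = ½ `weight₀ n` + `rest`, and `rest` is nonnegative
-- by `½≤leibniz`.
weight₀≤2 : ∀ n → weight₀ n ≤ 2ℚ
weight₀≤2 n = begin
  weight₀ n                   ≡⟨ solve 1 (λ w → w := con 2ℚ :* (con ½ :* w)) refl (weight₀ n) ⟩
  2ℚ * (½ * weight₀ n)        ≤⟨ *-monoˡ {r = 2ℚ} (<⇒≤ 0<2) (≤-+ʳ {½ * weight₀ n} 0≤rest) ⟩
  2ℚ * (½ * weight₀ n + rest) ≡⟨ cong (2ℚ *_) (trans (sym (altSum-byParts leibniz-isAltSeries n ½)) (altSum-recipOdd n)) ⟩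
  2ℚ * 1ℚ                     ≡⟨⟩
  2ℚ                          ∎
  where
  open ≤-Reasoning
  rest = partialSum (λ k → (leibnizSum (suc k) - ½) * weightDrop n k) (suc n)
  0≤rest : 0ℚ ≤ rest
  0≤rest = subst (_≤ rest) (partialSum-zero (suc n)) (partialSum-mono (suc n) λ k k<1+n →
    0≤* (≤⇒0≤- (½≤leibniz k)) (0≤weightDrop n k (ℕ.s≤s⁻¹ k<1+n)))

-- Only the factor `recipOdd n` depends on `n`, so each fixed drop tends to 0.
weightDrop≤ : ∀ n k → k ℕ.≤ n → weightDrop n k ≤ recipOdd n * (2ℚ * (odd k + odd (suc k)))
weightDrop≤ n k k≤n = begin
  weightDrop n k                                 ≡⟨ weightDrop≡ n k ⟩
  recipOdd n * (odd k * weight n k + odd (suc k) * weight n (suc k))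
    ≤⟨ *-monoˡ (0≤recipOdd n) (+-mono-≤
         (*-monoˡ (<⇒≤ (0<odd k)) (≤-trans (weight≤weight₀ n k (ℕ.m≤n⇒m≤1+n k≤n)) (weight₀≤2 n)))
         (*-monoˡ (<⇒≤ (0<odd (suc k))) (≤-trans (weight≤weight₀ n (suc k) (ℕ.s≤s k≤n)) (weight₀≤2 n)))) ⟩
  recipOdd n * (odd k * 2ℚ + odd (suc k) * 2ℚ)   ≡⟨ solve 4 (λ y p q t → y :* (p :* t :+ q :* t) := y :* (t :* (p :+ q))) refl (recipOdd n) (odd k) (odd (suc k)) 2ℚ ⟩
  recipOdd n * (2ℚ * (odd k + odd (suc k)))      ∎
  where open ≤-Reasoning

-- Null sequences and the limit of the weighted sums.

IsNull : (ℕ → ℚ) → Set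
IsNull x = ∀ ε → 0ℚ < ε → ∃ λ N → ∀ n → N ℕ.≤ n → ∣ x n ∣ < ε

-- A Cauchy sequence is eventually bounded, so its product with a null sequence is null. The index
-- `suc n` matches the truncation that belongs to row `n`.
≃-from-null : ∀ x y {u v} → IsNull u → IsNull v →
  (∀ n → seq x (suc n) - seq y (suc n) ≡ u n + (- seq y (suc n)) * v n) → x ≃ y
≃-from-null x y {u} {v} uNull vNull error ε 0<ε = suc (K ℕ.+ (M ℕ.+ N)) , close
  where
  open ≤-Reasoning
  δ       = proj₁ (half 0<ε)
  0<δ     = proj₁ (proj₂ (half 0<ε))
  δ+δ≡ε   = proj₂ (proj₂ (half 0<ε))
  B       = proj₁ (eventually-bounded y)
  0<B     = proj₁ (proj₂ (eventually-bounded y))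
  K       = proj₁ (proj₂ (proj₂ (eventually-bounded y)))
  bounded = proj₂ (proj₂ (proj₂ (eventually-bounded y)))
  M       = proj₁ (uNull δ 0<δ)
  uM      = proj₂ (uNull δ 0<δ)
  0<δ/B   = 0<* (0<recip 0<B) 0<δ
  N       = proj₁ (vNull (recip B * δ) 0<δ/B)
  vN      = proj₂ (vNull (recip B * δ) 0<δ/B)
  close : ∀ n → suc (K ℕ.+ (M ℕ.+ N)) ℕ.≤ n → ∣ seq x n - seq y n ∣ < ε
  close (suc n) (ℕ.s≤s p) = let q = ℕ.m+n≤o⇒n≤o K p in begin-strict
    ∣ seq x (suc n) - seq y (suc n) ∣      ≡⟨ cong ∣_∣ (error n) ⟩
    ∣ u n + (- seq y (suc n)) * v n ∣      ≤⟨ ∣p+q∣≤∣p∣+∣q∣ (u n) ((- seq y (suc n)) * v n) ⟩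
    ∣ u n ∣ + ∣ (- seq y (suc n)) * v n ∣
      <⟨ +-mono-< (uM n (ℕ.m+n≤o⇒m≤o M q)) (∣*∣-bound (- seq y (suc n)) (v n) 0<B
           (subst (_≤ B) (sym (∣-p∣≡∣p∣ (seq y (suc n)))) (bounded (suc n) (ℕ.m≤n⇒m≤1+n (ℕ.m+n≤o⇒m≤o K p))))
           (vN n (ℕ.m+n≤o⇒n≤o M q))) ⟩
    δ + δ                                  ≡⟨ δ+δ≡ε ⟩
    ε                                      ∎

-- `recipOdd` lies below `Q`, which tends to 0. The scaling uses `1ℚ + M` because `M` may be 0.
recipOdd*-isNull : ∀ {M} → 0ℚ ≤ M → ∀ ε → 0ℚ < ε → ∃ λ N → ∀ n → N ℕ.≤ n → recipOdd n * M < ε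
recipOdd*-isNull {M} 0≤M ε 0<ε = N , λ n N≤n → begin-strict
  recipOdd n * M           ≤⟨ *-mono (0≤recipOdd n) (<⇒≤ 0<1+M) (recipOdd-mono N≤n) M≤1+M ⟩
  recipOdd N * (1ℚ + M)    ≡⟨ *-comm (recipOdd N) (1ℚ + M) ⟩
  (1ℚ + M) * recipOdd N    <⟨ scale-recip 0<1+M (≤-<-trans y≤Q (proj₂ small)) ⟩
  ε                        ∎
  where
  open ≤-Reasoning
  0<1+M : 0ℚ < 1ℚ + M
  0<1+M = subst (0ℚ <_) (+-comm M 1ℚ) (0<+ 0≤M (positive⁻¹ 1ℚ))
  M≤1+M : M ≤ 1ℚ + M
  M≤1+M = subst (M ≤_) (+-comm M 1ℚ) (≤-+ʳ 0≤1)
  small = Q→0 (recip (1ℚ + M) * ε) (0<* (0<recip 0<1+M) 0<ε)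
  N     = proj₁ small
  y≤Q : recipOdd N ≤ Q N
  y≤Q = subst (_≤ Q N) (*-identityˡ (recipOdd N)) (*-monoʳ (0≤recipOdd N) (1≤P N))

-- The Silverman–Toeplitz argument: the drops are nonnegative, have bounded sum, and each of
-- them tends to 0.
altSum-toeplitz : ∀ {f C} → IsAltSeries f C → IsCauchy C → IsNull (λ n → altSum n f - C (suc n) * weight₀ n)
altSum-toeplitz {f} {C} series cauchy ε 0<ε = K ℕ.+ N , λ n K+N≤n → begin-strict
  ∣ altSum n f - C (suc n) * weight₀ n ∣    ≡⟨ cong ∣_∣ (difference n) ⟩
  ∣ partialSum (term n) (suc n) ∣           ≤⟨ ∣partialSum∣≤ (term n) (suc n) ⟩
  partialSum (λ k → ∣ term n k ∣) (suc n)   ≡⟨ cong (partialSum (λ k → ∣ term n k ∣)) (ℕ.m∸n+n≡m (K≤1+n K+N≤n)) ⟨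
  partialSum (λ k → ∣ term n k ∣) (suc n ℕ.∸ K ℕ.+ K)   ≡⟨ partialSum-split (λ k → ∣ term n k ∣) K (suc n ℕ.∸ K) ⟩
  partialSum (λ k → ∣ term n k ∣) K + partialSum (λ i → ∣ term n (i ℕ.+ K) ∣) (suc n ℕ.∸ K)
    ≤⟨ +-mono-≤ (head n K+N≤n) (tail n K+N≤n) ⟩
  recipOdd n * M + η * 2ℚ                   <⟨ +-monoˡ-< (η * 2ℚ) (small n (ℕ.m+n≤o⇒n≤o K K+N≤n)) ⟩
  δ + η * 2ℚ                                ≡⟨ cong (δ +_) (trans (solve 1 (λ h → h :* con 2ℚ := h :+ h) refl η) η+η≡δ) ⟩
  δ + δ                                     ≡⟨ δ+δ≡ε ⟩
  ε                                         ∎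
  where
  open ≤-Reasoning
  δ     = proj₁ (half 0<ε)
  0<δ   = proj₁ (proj₂ (half 0<ε))
  δ+δ≡ε = proj₂ (proj₂ (half 0<ε))
  η     = proj₁ (half 0<δ)
  0<η   = proj₁ (proj₂ (half 0<δ))
  η+η≡δ = proj₂ (proj₂ (half 0<δ))
  K     = proj₁ (cauchy η 0<η)
  near  = proj₂ (cauchy η 0<η)
  -- Going through `C K` in the triangle inequality removes `n` from the estimate, so `M` is a
  -- constant and `recipOdd n * M` is null.
  bound : ℕ → ℚ
  bound k = (∣ C (suc k) - C K ∣ + η) * (2ℚ * (odd k + odd (suc k)))
  M     = partialSum bound K
  0≤M : 0ℚ ≤ M
  0≤M = subst (_≤ M) (partialSum-zero K) (partialSum-mono K λ k _ →
    0≤* (0≤+ (0≤∣p∣ (C (suc k) - C K)) (<⇒≤ 0<η)) (0≤* (<⇒≤ 0<2) (<⇒≤ (0<odd+odd k (suc k)))))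
  N     = proj₁ (recipOdd*-isNull 0≤M δ 0<δ)
  small = proj₂ (recipOdd*-isNull 0≤M δ 0<δ)
  term : ℕ → ℕ → ℚ
  term n k = (C (suc k) - C (suc n)) * weightDrop n k
  difference : ∀ n → altSum n f - C (suc n) * weight₀ n ≡ partialSum (term n) (suc n)
  difference n = trans (cong (_- C (suc n) * weight₀ n) (altSum-byParts series n (C (suc n))))
    (solve 2 (λ a b → a :+ b :- a := b) refl (C (suc n) * weight₀ n) (partialSum (term n) (suc n)))
  ∣term∣ : ∀ n k → k ℕ.≤ n → ∣ term n k ∣ ≡ ∣ C (suc k) - C (suc n) ∣ * weightDrop n k
  ∣term∣ n k k≤n = trans (∣p*q∣≡∣p∣*∣q∣ (C (suc k) - C (suc n)) (weightDrop n k))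
    (cong (∣ C (suc k) - C (suc n) ∣ *_) (0≤p⇒∣p∣≡p (0≤weightDrop n k k≤n)))
  K≤n : ∀ {n} → K ℕ.+ N ℕ.≤ n → K ℕ.≤ n
  K≤n = ℕ.m+n≤o⇒m≤o K
  K≤1+n : ∀ {n} → K ℕ.+ N ℕ.≤ n → K ℕ.≤ suc n
  K≤1+n p = ℕ.m≤n⇒m≤1+n (K≤n p)
  head : ∀ n → K ℕ.+ N ℕ.≤ n → partialSum (λ k → ∣ term n k ∣) K ≤ recipOdd n * M
  head n p = subst (partialSum (λ k → ∣ term n k ∣) K ≤_) (partialSum-* (recipOdd n) bound K)
    (partialSum-mono K λ k k<K → let k≤n = ℕ.≤-trans (ℕ.<⇒≤ k<K) (K≤n p) in begin
      ∣ term n k ∣                                   ≡⟨ ∣term∣ n k k≤n ⟩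
      ∣ C (suc k) - C (suc n) ∣ * weightDrop n k
        ≤⟨ *-mono (0≤∣p∣ (C (suc k) - C (suc n))) (0≤* (0≤recipOdd n) (0≤* (<⇒≤ 0<2) (<⇒≤ (0<odd+odd k (suc k)))))
             (≤-trans (∣-∣-triangle (C (suc k)) (C K) (C (suc n)))
               (+-monoʳ-≤ ∣ C (suc k) - C K ∣ (<⇒≤ (near K (suc n) ℕ.≤-refl (K≤1+n p)))))
             (weightDrop≤ n k k≤n) ⟩
      (∣ C (suc k) - C K ∣ + η) * (recipOdd n * (2ℚ * (odd k + odd (suc k))))
        ≡⟨ solve 3 (λ a y b → a :* (y :* b) := y :* (a :* b)) refl (∣ C (suc k) - C K ∣ + η) (recipOdd n) (2ℚ * (odd k + odd (suc k))) ⟩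
      recipOdd n * bound k                           ∎)
  tail : ∀ n → K ℕ.+ N ℕ.≤ n → partialSum (λ i → ∣ term n (i ℕ.+ K) ∣) (suc n ℕ.∸ K) ≤ η * 2ℚ
  tail n p = begin
    partialSum (λ i → ∣ term n (i ℕ.+ K) ∣) L   ≤⟨ partialSum-mono L (λ i i<L → let i+K≤n = inRange i i<L in begin
      ∣ term n (i ℕ.+ K) ∣                      ≡⟨ ∣term∣ n (i ℕ.+ K) i+K≤n ⟩
      ∣ C (suc (i ℕ.+ K)) - C (suc n) ∣ * weightDrop n (i ℕ.+ K)
        ≤⟨ *-monoʳ (0≤weightDrop n (i ℕ.+ K) i+K≤n) (<⇒≤ (near (suc (i ℕ.+ K)) (suc n) (ℕ.m≤n+m K (suc i)) (K≤1+n p))) ⟩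
      η * weightDrop n (i ℕ.+ K)                ∎) ⟩
    partialSum (λ i → η * weightDrop n (i ℕ.+ K)) L   ≡⟨ partialSum-* η (λ i → weightDrop n (i ℕ.+ K)) L ⟩
    η * partialSum (λ i → weightDrop n (i ℕ.+ K)) L   ≡⟨ cong (η *_) (partialSum-telescope (λ i → weight n (i ℕ.+ K)) (λ _ → refl) L) ⟩
    η * (weight n K - weight n (L ℕ.+ K))       ≤⟨ *-monoˡ (<⇒≤ 0<η) (≤-trans (-≤ (0≤weight n (L ℕ.+ K) (ℕ.≤-reflexive L+K≡1+n)))
                                                     (≤-trans (weight≤weight₀ n K (K≤1+n p)) (weight₀≤2 n))) ⟩
    η * 2ℚ                                      ∎
    where
    L = suc n ℕ.∸ K
    L+K≡1+n : L ℕ.+ K ≡ suc n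
    L+K≡1+n = ℕ.m∸n+n≡m (K≤1+n p)
    inRange : ∀ i → i ℕ.< L → i ℕ.+ K ℕ.≤ n
    inRange i i<L = ℕ.s≤s⁻¹ (subst (suc i ℕ.+ K ℕ.≤_) L+K≡1+n (ℕ.+-monoˡ-≤ K i<L))

-- Rational sums over lists.

listSum : ∀ {A : Set} → List A → (A → ℚ) → ℚ
listSum xs g = foldr (λ x s → g x + s) 0ℚ xs

seq-sumOver : ∀ {A : Set} (xs : List A) f n → seq (sumOver xs f) n ≡ listSum xs (λ x → seq (f x) n)
seq-sumOver []       f n = refl
seq-sumOver (x ∷ xs) f n = cong (seq (f x) n +_) (seq-sumOver xs f n)

listSum-cong : ∀ {A : Set} (xs : List A) {f g} → (∀ x → f x ≡ g x) → listSum xs f ≡ listSum xs g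
listSum-cong []       f≡g = refl
listSum-cong (x ∷ xs) f≡g = cong₂ _+_ (f≡g x) (listSum-cong xs f≡g)

listSum-+ : ∀ {A : Set} (xs : List A) f g → listSum xs (λ x → f x + g x) ≡ listSum xs f + listSum xs g
listSum-+ []       f g = refl
listSum-+ (x ∷ xs) f g = trans (cong (f x + g x +_) (listSum-+ xs f g))
  (solve 4 (λ a b c d → (a :+ b) :+ (c :+ d) := (a :+ c) :+ (b :+ d)) refl (f x) (g x) (listSum xs f) (listSum xs g))

listSum-* : ∀ {A : Set} (xs : List A) c f → listSum xs (λ x → c * f x) ≡ c * listSum xs f
listSum-* []       c f = sym (*-zeroʳ c)
listSum-* (x ∷ xs) c f = trans (cong (c * f x +_) (listSum-* xs c f)) (sym (*-distribˡ-+ c (f x) (listSum xs f)))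

listSum-zero : ∀ {A : Set} (xs : List A) → listSum xs (λ _ → 0ℚ) ≡ 0ℚ
listSum-zero []       = refl
listSum-zero (x ∷ xs) = trans (+-identityˡ _) (listSum-zero xs)

listSum-++ : ∀ {A : Set} (xs ys : List A) f → listSum (xs ++ ys) f ≡ listSum xs f + listSum ys f
listSum-++ []       ys f = sym (+-identityˡ (listSum ys f))
listSum-++ (x ∷ xs) ys f = trans (cong (f x +_) (listSum-++ xs ys f)) (sym (+-assoc (f x) (listSum xs f) (listSum ys f)))

listSum-map : ∀ {A B : Set} (h : A → B) xs f → listSum (map h xs) f ≡ listSum xs (f ∘ h)
listSum-map h []       f = refl
listSum-map h (x ∷ xs) f = cong (f (h x) +_) (listSum-map h xs f)

listSum-applyUpTo : ∀ (h : ℕ → ℕ) n f → listSum (applyUpTo h n) f ≡ partialSum (f ∘ h) n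
listSum-applyUpTo h zero    f = refl
listSum-applyUpTo h (suc n) f = trans (cong (f (h 0) +_) (listSum-applyUpTo (h ∘ suc) n f)) (sym (partialSum-head (f ∘ h) n))

listSum-partialSum : ∀ {A : Set} (xs : List A) (f : A → ℕ → ℚ) n →
  listSum xs (λ x → partialSum (f x) n) ≡ partialSum (λ k → listSum xs (λ x → f x k)) n
listSum-partialSum xs f zero    = listSum-zero xs
listSum-partialSum xs f (suc n) = trans (listSum-+ xs (λ x → partialSum (f x) n) (λ x → f x n))
  (cong (_+ listSum xs (λ x → f x n)) (listSum-partialSum xs f n))

-- Multiple t-sums over compositions, layer by layer.

compositions-empty : ∀ {r n} → n ℕ.< r → compositions r n ≡ []
compositions-empty {suc r} {zero}  _           = refl
compositions-empty {suc r} {suc n} (ℕ.s≤s n<r) =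
  cong₂ (λ us vs → map prepend-1 us ++ map increment-head vs)
    (compositions-empty n<r) (compositions-empty (ℕ.m≤n⇒m≤1+n n<r))

-- The summand of t(s₁, …, s_{r-1}, 2b+1+s_r) with outermost index k₁ = suc k.
layer : ℕ → ∀ {r} → Vec ℕ (suc r) → ℕ → ℚ
layer b (s ∷ [])    k = recipOdd k ^ (2 ℕ.* b ℕ.+ 1 ℕ.+ s)
layer b (s ∷ u ∷ v) k = recipOdd k ^ s * tSum (tailIndex b (u ∷ v)) k

1^n≡1 : ∀ n → 1ℚ ^ n ≡ 1ℚ
1^n≡1 zero    = refl
1^n≡1 (suc n) = trans (*-identityˡ _) (1^n≡1 n)

tSum-tail : ∀ b {r} (v : Vec ℕ (suc r)) n → tSum (tailIndex b v) n ≡ partialSum (layer b v) n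
tSum-tail b (s ∷ [])    zero    = refl
tSum-tail b (s ∷ u ∷ v) zero    = refl
tSum-tail b (s ∷ [])    (suc n) = cong₂ _+_ (tSum-tail b (s ∷ []) n)
  (trans (cong (λ e → e * p * 1ℚ) (1^n≡1 (suc n))) (trans (*-identityʳ (1ℚ * p)) (*-identityˡ p)))
  where p = recipOdd n ^ (2 ℕ.* b ℕ.+ 1 ℕ.+ s)
tSum-tail b (s ∷ u ∷ v) (suc n) = cong₂ _+_ (tSum-tail b (s ∷ u ∷ v) n)
  (cong (_* tSum (tailIndex b (u ∷ v)) n) (trans (cong (_* p) (1^n≡1 (suc n))) (*-identityˡ p)))
  where p = recipOdd n ^ s

tSum-bar-zero : ∀ a b {r} (v : Vec ℕ (suc r)) → tSum (barIndex a b v) 0 ≡ 0ℚ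
tSum-bar-zero a b (s ∷ [])    = refl
tSum-bar-zero a b (s ∷ u ∷ v) = refl

-- The factor with exponent 2a+1 splits off in every depth: for r = 1 the exponent 2a+2b+2+s is
-- (2a+1) + (2b+1+s), which makes that convention fit the general pattern. The minus sign appears
-- because `tSum` raises the sign to `suc n` and `altSign` to `n`.
tSum-bar-suc : ∀ a b {r} (v : Vec ℕ (suc r)) n → tSum (barIndex a b v) (suc n)
  ≡ tSum (barIndex a b v) n + - altSign n * recipOdd n ^ (2 ℕ.* a ℕ.+ 1) * layer b v n
tSum-bar-suc a b (s ∷ []) n = cong (tSum (barIndex a b (s ∷ [])) n +_) (begin
  - 1ℚ * e * y ^ (2 ℕ.* a ℕ.+ 2 ℕ.* b ℕ.+ 2 ℕ.+ s) * 1ℚ   ≡⟨ cong (λ j → - 1ℚ * e * y ^ j * 1ℚ) exponent ⟩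
  - 1ℚ * e * y ^ (2 ℕ.* a ℕ.+ 1 ℕ.+ (2 ℕ.* b ℕ.+ 1 ℕ.+ s)) * 1ℚ
    ≡⟨ cong (λ z → - 1ℚ * e * z * 1ℚ) (^-homo-* y (2 ℕ.* a ℕ.+ 1) (2 ℕ.* b ℕ.+ 1 ℕ.+ s)) ⟩
  - 1ℚ * e * (p * q) * 1ℚ     ≡⟨ solve 3 (λ e p q → (:- con 1ℚ) :* e :* (p :* q) :* con 1ℚ := (:- e) :* p :* q) refl e p q ⟩
  - e * p * q                 ∎)
  where
  open ≡-Reasoning
  y = recipOdd n
  e = altSign n
  p = y ^ (2 ℕ.* a ℕ.+ 1)
  q = y ^ (2 ℕ.* b ℕ.+ 1 ℕ.+ s)
  exponent : 2 ℕ.* a ℕ.+ 2 ℕ.* b ℕ.+ 2 ℕ.+ s ≡ 2 ℕ.* a ℕ.+ 1 ℕ.+ (2 ℕ.* b ℕ.+ 1 ℕ.+ s)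
  exponent = ℕSolver.solve 3 (λ x z s → x ℕSolver.:+ z ℕSolver.:+ ℕSolver.con 2 ℕSolver.:+ s
    ℕSolver.:= x ℕSolver.:+ ℕSolver.con 1 ℕSolver.:+ (z ℕSolver.:+ ℕSolver.con 1 ℕSolver.:+ s)) refl (2 ℕ.* a) (2 ℕ.* b) s
tSum-bar-suc a b (s ∷ u ∷ v) n = cong (tSum (barIndex a b (s ∷ u ∷ v)) n +_) (begin
  - 1ℚ * e * y ^ (2 ℕ.* a ℕ.+ 1 ℕ.+ s) * x   ≡⟨ cong (λ z → - 1ℚ * e * z * x) (^-homo-* y (2 ℕ.* a ℕ.+ 1) s) ⟩
  - 1ℚ * e * (p * q) * x       ≡⟨ solve 4 (λ e p q x → (:- con 1ℚ) :* e :* (p :* q) :* x := (:- e) :* p :* (q :* x)) refl e p q x ⟩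
  - e * p * (q * x)            ∎)
  where
  open ≡-Reasoning
  y = recipOdd n
  e = altSign n
  p = y ^ (2 ℕ.* a ℕ.+ 1)
  q = y ^ s
  x = tSum (tailIndex b (u ∷ v)) n

-- The argument `r` stands for depth `suc r`, as does the summation index in the theorem.
layerSum : ℕ → ℕ → ℕ → ℕ → ℚ
layerSum b r m k = listSum (compositions (suc r) m) (λ u → layer b (parts u) k)

layer-prepend : ∀ b {r m} (u : Composition (suc r) m) k →
  layer b (parts (prepend-1 u)) k ≡ recipOdd k * partialSum (layer b (parts u)) k
layer-prepend b (mkComposition (s ∷ v) _ _) k =
  cong₂ _*_ (*-identityʳ (recipOdd k)) (tSum-tail b (s ∷ v) k)

layer-increment : ∀ b {r m} (u : Composition (suc r) m) k →
  layer b (parts (increment-head u)) k ≡ recipOdd k * layer b (parts u) k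
layer-increment b (mkComposition (s ∷ [])    (_ Vec.∷ _) _) k = cong (recipOdd k ^_) (ℕ.+-suc (2 ℕ.* b ℕ.+ 1) s)
layer-increment b (mkComposition (s ∷ u ∷ v) (_ Vec.∷ _) _) k =
  *-assoc (recipOdd k) (recipOdd k ^ s) (tSum (tailIndex b (u ∷ v)) k)

layerSum-increment : ∀ b r m k →
  listSum (map increment-head (compositions (suc r) m)) (λ u → layer b (parts u) k) ≡ recipOdd k * layerSum b r m k
layerSum-increment b r m k = trans (listSum-map increment-head (compositions (suc r) m) (λ u → layer b (parts u) k))
  (trans (listSum-cong (compositions (suc r) m) (λ u → layer-increment b u k))
    (listSum-* (compositions (suc r) m) (recipOdd k) (λ u → layer b (parts u) k)))

-- The two branches of `compositions`: removing a leading 1 leaves an inner sum over j < k at the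
-- smaller depth, and decrementing the head costs one factor `recipOdd k`.
layerSum-suc-suc : ∀ b r m k →
  layerSum b (suc r) (suc m) k ≡ recipOdd k * partialSum (layerSum b r m) k + recipOdd k * layerSum b (suc r) m k
layerSum-suc-suc b r m k = trans
  (listSum-++ (map prepend-1 us) (map increment-head (compositions (suc (suc r)) m)) (λ u → layer b (parts u) k))
  (cong₂ _+_ prepended (layerSum-increment b (suc r) m k))
  where
  open ≡-Reasoning
  us = compositions (suc r) m
  prepended : listSum (map prepend-1 us) (λ u → layer b (parts u) k) ≡ recipOdd k * partialSum (layerSum b r m) k
  prepended = begin
    listSum (map prepend-1 us) (λ u → layer b (parts u) k)   ≡⟨ listSum-map prepend-1 us (λ u → layer b (parts u) k) ⟩
    _ ≡⟨ listSum-cong us (λ u → layer-prepend b u k) ⟩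
    listSum us (λ u → recipOdd k * partialSum (layer b (parts u)) k)   ≡⟨ listSum-* us (recipOdd k) _ ⟩
    recipOdd k * listSum us (λ u → partialSum (layer b (parts u)) k)   ≡⟨ cong (recipOdd k *_) (listSum-partialSum us (λ u → layer b (parts u)) k) ⟩
    recipOdd k * partialSum (layerSum b r m) k               ∎

layerSum-diagonal : ∀ b m k → layerSum b m m k ≡ 0ℚ
layerSum-diagonal b m k = cong (λ us → listSum us (λ u → layer b (parts u) k)) (compositions-empty (ℕ.n<1+n m))

-- Powers of `shift` as sums over compositions.

-- Formed in ℕ first, to agree with the coefficients in the theorem.
2^ : ℕ → ℚ
2^ i = fromℕ (2 ℕ.^ i)

2^-suc : ∀ i → 2^ (suc i) ≡ 2^ i + 2^ i
2^-suc i = trans (cong (λ j → fromℕ (2 ℕ.^ i ℕ.+ j)) (ℕ.+-identityʳ (2 ℕ.^ i))) (fromℕ-+ (2 ℕ.^ i) (2 ℕ.^ i))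

-- All depths 1 to `m`, with depth r weighted by 2 to the power r-1; the remaining factor 2 surfaces
-- in `X-suc`.
chainSum : ℕ → ℕ → ℕ → ℚ
chainSum b m k = partialSum (λ i → 2^ i * layerSum b i m k) m

-- Prepending raises the depth and so doubles the coefficient, giving two copies of the sum over j <
-- k. Incrementing keeps the depth and gives the term at k, which completes one copy to j ≤ k.
chainSum-suc : ∀ b m k → chainSum b (suc (suc m)) k
  ≡ recipOdd k * (partialSum (chainSum b (suc m)) (suc k) + partialSum (chainSum b (suc m)) k)
chainSum-suc b m k = begin
  chainSum b (suc N) k   ≡⟨ partialSum-head (λ i → 2^ i * layerSum b i (suc N) k) N ⟩
  2^ 0 * layerSum b 0 (suc N) k + partialSum (λ i → 2^ (suc i) * layerSum b (suc i) (suc N) k) N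
    -- At depth 1 only the increment branch remains: `compositions 0 N` is empty since `N` is a
    -- successor.
    ≡⟨ cong₂ (λ x z → 2^ 0 * x + z) (layerSum-increment b 0 N k) (partialSum-cong term N) ⟩
  2^ 0 * (y * layerSum b 0 N k)
    + partialSum (λ i → y * (2^ (suc i) * layerSum b (suc i) N k) + y * (inner i + inner i)) N
    ≡⟨ cong (2^ 0 * (y * layerSum b 0 N k) +_) (trans (partialSum-+ _ _ N)
         (cong₂ _+_ (partialSum-* y _ N) (trans (partialSum-* y _ N) (cong (y *_) (partialSum-+ inner inner N))))) ⟩
  2^ 0 * (y * layerSum b 0 N k) + (y * outer + y * (partialSum inner N + partialSum inner N))
    ≡⟨ solve 5 (λ a y l o i → a :* (y :* l) :+ (y :* o :+ y :* (i :+ i)) := y :* ((a :* l :+ o) :+ (i :+ i))) refl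
         (2^ 0) y (layerSum b 0 N k) outer (partialSum inner N) ⟩
  y * ((2^ 0 * layerSum b 0 N k + outer) + (partialSum inner N + partialSum inner N))
    ≡⟨ cong₂ (λ a i → y * (a + (i + i))) collect exchange ⟩
  y * (chainSum b N k + (d + d))   ≡⟨ solve 3 (λ y c d → y :* (c :+ (d :+ d)) := y :* ((d :+ c) :+ d)) refl y (chainSum b N k) d ⟩
  y * ((d + chainSum b N k) + d)   ∎
  where
  open ≡-Reasoning
  N = suc m
  y = recipOdd k
  d = partialSum (chainSum b N) k
  inner : ℕ → ℚ
  inner i = 2^ i * partialSum (layerSum b i N) k
  outer = partialSum (λ i → 2^ (suc i) * layerSum b (suc i) N k) N
  term : ∀ i → 2^ (suc i) * layerSum b (suc i) (suc N) k
             ≡ y * (2^ (suc i) * layerSum b (suc i) N k) + y * (inner i + inner i)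
  term i = begin
    p′ * layerSum b (suc i) (suc N) k   ≡⟨ cong (p′ *_) (layerSum-suc-suc b i N k) ⟩
    p′ * (y * x + y * l)                ≡⟨ solve 4 (λ p y x l → p :* (y :* x :+ y :* l) := y :* (p :* l) :+ y :* (p :* x)) refl p′ y x l ⟩
    y * (p′ * l) + y * (p′ * x)         ≡⟨ cong (λ z → y * (p′ * l) + y * z) (trans (cong (_* x) (2^-suc i)) (*-distribʳ-+ x (2^ i) (2^ i))) ⟩
    y * (p′ * l) + y * (inner i + inner i)   ∎
    where
    p′ = 2^ (suc i)
    x  = partialSum (layerSum b i N) k
    l  = layerSum b (suc i) N k
  collect : 2^ 0 * layerSum b 0 N k + outer ≡ chainSum b N k
  -- Joining the depth-1 term to `outer` gives a sum with one extra term, `i = N`; it is 0 because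
  -- `suc N` positive parts cannot total `N`.
  collect = trans (sym (partialSum-head (λ i → 2^ i * layerSum b i N k) N))
    (trans (cong (λ z → chainSum b N k + 2^ N * z) (layerSum-diagonal b N k))
      (solve 2 (λ c p → c :+ p :* con 0ℚ := c) refl (chainSum b N k) (2^ N)))
  exchange : partialSum inner N ≡ d
  exchange = trans (partialSum-cong (λ i → sym (partialSum-* (2^ i) (layerSum b i N) k)) N)
    (partialSum-swap (λ i j → 2^ i * layerSum b i N j) N k)

-- The recurrence of `chainSum` is that of `shift` conjugated by multiplication with `recipOdd k`.
-- The start is the single composition of 1.
chainSum≡fold : ∀ b m k →
  chainSum b (suc m) k ≡ recipOdd k * fold (λ j → recipOdd j ^ (2 ℕ.* b) * recipOdd j) shift m k
chainSum≡fold b zero k = begin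
  0ℚ + 1ℚ * (y ^ (2 ℕ.* b ℕ.+ 1 ℕ.+ 1) + 0ℚ)   ≡⟨ cong (λ z → 0ℚ + 1ℚ * (z + 0ℚ)) power ⟩
  0ℚ + 1ℚ * (y ^ (2 ℕ.* b) * (y * 1ℚ) * (y * 1ℚ) + 0ℚ)
    ≡⟨ solve 2 (λ p y → con 0ℚ :+ con 1ℚ :* (p :* (y :* con 1ℚ) :* (y :* con 1ℚ) :+ con 0ℚ) := y :* (p :* y)) refl (y ^ (2 ℕ.* b)) y ⟩
  y * (y ^ (2 ℕ.* b) * y)   ∎
  where
  open ≡-Reasoning
  y = recipOdd k
  power : y ^ (2 ℕ.* b ℕ.+ 1 ℕ.+ 1) ≡ y ^ (2 ℕ.* b) * (y * 1ℚ) * (y * 1ℚ)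
  power = trans (^-homo-* y (2 ℕ.* b ℕ.+ 1) 1) (cong (_* (y * 1ℚ)) (^-homo-* y (2 ℕ.* b) 1))
chainSum≡fold b (suc m) k = trans (chainSum-suc b m k) (cong (recipOdd k *_)
  (cong₂ _+_ (partialSum-cong (chainSum≡fold b m) (suc k)) (partialSum-cong (chainSum≡fold b m) k)))

-- The right-hand side and the comparison of limits.

module _ (a b c : ℕ) where

  private
    T⋆ RHS X : ℝ
    T⋆  = t⋆ (replicate a 2 ++ (c ℕ.+ 3) ∷ replicate b 2) (starIndex-admissible a b c)
    X   = ∑[ i ← upTo (c ℕ.+ 2) ] (fromℚ (fromℕ (2 ℕ.^ suc i)) *ᴿ
            (∑[ s ← compositions (suc i) (c ℕ.+ 2) ] (t (barIndex a b (parts s)) (barIndex-converges a b s))))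
    RHS = (-ᴿ (fromℚ (fromℕ 2) *ᴿ inv π π#0)) *ᴿ X

    barSum : ℕ → ℕ → ℚ
    barSum i n = listSum (compositions (suc i) (c ℕ.+ 2)) (λ s → tSum (barIndex a b (parts s)) n)

    seq-X : ∀ n → seq X n ≡ partialSum (λ i → 2^ (suc i) * barSum i n) (c ℕ.+ 2)
    seq-X n = trans (seq-sumOver (upTo (c ℕ.+ 2)) _ n) (trans
      (listSum-cong (upTo (c ℕ.+ 2)) λ i → cong (2^ (suc i) *_) (seq-sumOver (compositions (suc i) (c ℕ.+ 2)) _ n))
      (listSum-applyUpTo id (c ℕ.+ 2) (λ i → 2^ (suc i) * barSum i n)))

    chainSum≡summand : ∀ k → recipOdd k ^ (2 ℕ.* a ℕ.+ 1) * chainSum b (c ℕ.+ 2) k ≡ summand a b c k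
    chainSum≡summand k = trans (cong₂ _*_ (^-homo-* y (2 ℕ.* a) 1)
        (trans (cong (λ m → chainSum b m k) (ℕ.+-comm c 2)) (chainSum≡fold b (suc c) k)))
      (solve 3 (λ p y x → p :* (y :* con 1ℚ) :* (y :* x) := p :* (y :* y :* x)) refl (y ^ (2 ℕ.* a)) y _)
      where y = recipOdd k

    barSum-zero : ∀ i → barSum i 0 ≡ 0ℚ
    barSum-zero i = trans (listSum-cong us λ s → tSum-bar-zero a b (parts s)) (listSum-zero us)
      where us = compositions (suc i) (c ℕ.+ 2)

    barSum-suc : ∀ i n → barSum i (suc n)
      ≡ barSum i n + - altSign n * recipOdd n ^ (2 ℕ.* a ℕ.+ 1) * layerSum b i (c ℕ.+ 2) n
    barSum-suc i n = trans (listSum-cong us λ s → tSum-bar-suc a b (parts s) n)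
      (trans (listSum-+ us (λ s → tSum (barIndex a b (parts s)) n) (λ s → q * layer b (parts s) n))
        (cong (barSum i n +_) (listSum-* us q (λ s → layer b (parts s) n))))
      where
      us = compositions (suc i) (c ℕ.+ 2)
      q  = - altSign n * recipOdd n ^ (2 ℕ.* a ℕ.+ 1)

    X-zero : seq X 0 ≡ 0ℚ
    X-zero = trans (seq-X 0) (trans
      (partialSum-cong (λ i → trans (cong (2^ (suc i) *_) (barSum-zero i)) (*-zeroʳ (2^ (suc i)))) (c ℕ.+ 2))
      (partialSum-zero (c ℕ.+ 2)))

    -- The -2 collects the sign of the barred entry and the factor by which `2^ (suc i)` exceeds
    -- `2^ i`.
    X-suc : ∀ n → seq X (suc n) ≡ seq X n + (- 2ℚ) * (altSign n * summand a b c n)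
    X-suc n = begin
      seq X (suc n)                                         ≡⟨ seq-X (suc n) ⟩
      partialSum (λ i → 2^ (suc i) * barSum i (suc n)) N    ≡⟨ partialSum-cong term N ⟩
      partialSum (λ i → 2^ (suc i) * barSum i n + (- 2ℚ) * (e * p) * (2^ i * layerSum b i N n)) N
        ≡⟨ partialSum-+ _ _ N ⟩
      _ ≡⟨ cong₂ _+_ (sym (seq-X n)) (partialSum-* ((- 2ℚ) * (e * p)) _ N) ⟩
      seq X n + (- 2ℚ) * (e * p) * chainSum b N n
        ≡⟨ cong (seq X n +_) (solve 4 (λ t e p x → t :* (e :* p) :* x := t :* (e :* (p :* x))) refl (- 2ℚ) e p (chainSum b N n)) ⟩
      seq X n + (- 2ℚ) * (e * (p * chainSum b N n))         ≡⟨ cong (λ z → seq X n + (- 2ℚ) * (e * z)) (chainSum≡summand n) ⟩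
      seq X n + (- 2ℚ) * (e * summand a b c n)              ∎
      where
      open ≡-Reasoning
      N = c ℕ.+ 2
      e = altSign n
      p = recipOdd n ^ (2 ℕ.* a ℕ.+ 1)
      term : ∀ i → 2^ (suc i) * barSum i (suc n)
                 ≡ 2^ (suc i) * barSum i n + (- 2ℚ) * (e * p) * (2^ i * layerSum b i N n)
      term i = begin
        2^ (suc i) * barSum i (suc n)              ≡⟨ cong (2^ (suc i) *_) (barSum-suc i n) ⟩
        2^ (suc i) * (barSum i n + - e * p * l)    ≡⟨ *-distribˡ-+ (2^ (suc i)) (barSum i n) (- e * p * l) ⟩
        2^ (suc i) * barSum i n + 2^ (suc i) * (- e * p * l)
          ≡⟨ cong (λ z → 2^ (suc i) * barSum i n + z * (- e * p * l)) (2^-suc i) ⟩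
        2^ (suc i) * barSum i n + (2^ i + 2^ i) * (- e * p * l)
          ≡⟨ cong (2^ (suc i) * barSum i n +_) (solve 4 (λ q e p l → (q :+ q) :* ((:- e) :* p :* l)
               := (:- con 2ℚ) :* (e :* p) :* (q :* l)) refl (2^ i) e p l) ⟩
        2^ (suc i) * barSum i n + (- 2ℚ) * (e * p) * (2^ i * l) ∎
        where l = layerSum b i N n

    -- The factor -½ undoes the -2 of `X-suc`, leaving the alternating series of `summand`. As a
    -- product of reals it is Cauchy by construction.
    C : ℝ
    C = fromℚ (- ½) *ᴿ X

    C-isAltSeries : IsAltSeries (summand a b c) (seq C)
    C-isAltSeries = mkAltSeries (trans (cong (- ½ *_) X-zero) (*-zeroʳ (- ½))) λ n →
      trans (cong (- ½ *_) (X-suc n))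
        (solve 2 (λ x f → (:- con ½) :* (x :+ (:- con 2ℚ) :* f) := (:- con ½) :* x :+ f) refl
          (seq X n) (altSign n * summand a b c n))

    -- At each stage π is 4 `l`, so -2/(4 `l`) times `l` is exactly -½. `½≤leibniz` ensures that
    -- `recip` is a genuine inverse.
    RHS*leibniz : ∀ n → seq RHS (suc n) * leibnizSum (suc n) ≡ seq C (suc n)
    RHS*leibniz n = begin
      - (fromℕ 2 * recip (fromℕ 4 * l)) * x * l
        ≡⟨ solve 3 (λ q x l → (:- (con (fromℕ 2) :* q)) :* x :* l := (:- con ½) :* x :* ((con (fromℕ 4) :* l) :* q)) refl
             (recip (fromℕ 4 * l)) x l ⟩
      - ½ * x * ((fromℕ 4 * l) * recip (fromℕ 4 * l))
        ≡⟨ cong (- ½ * x *_) (recip-inverse (0<⇒≢0 (0<* (0<fromℕ 3) 0<l))) ⟩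
      - ½ * x * 1ℚ    ≡⟨ *-identityʳ (- ½ * x) ⟩
      - ½ * x         ∎
      where
      open ≡-Reasoning
      l = leibnizSum (suc n)
      x = seq X (suc n)
      0<l : 0ℚ < l
      0<l = <-≤-trans (positive⁻¹ ½) (½≤leibniz n)

    -- With r `RHS`, l the Leibniz sum and w `weight₀ n`, adding and subtracting r l w splits the
    -- difference into two errors of the kind bounded by `altSum-toeplitz`. The 1 in the second is
    -- `altSum n recipOdd`, which is how l w is known to approach 1.
    error : ∀ n → seq T⋆ (suc n) - seq RHS (suc n)
      ≡ (altSum n (summand a b c) - seq C (suc n) * weight₀ n)
        + (- seq RHS (suc n)) * (altSum n recipOdd - leibnizSum (suc n) * weight₀ n)
    error n = begin
      seq T⋆ (suc n) - r         ≡⟨ cong (_- r) (t⋆Sum≡altSum a b c n) ⟩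
      s - r                      ≡⟨ solve 4 (λ s r l w → s :- r := (s :- (r :* l) :* w) :+ (:- r) :* (con 1ℚ :- l :* w)) refl s r l w ⟩
      (s - (r * l) * w) + (- r) * (1ℚ - l * w)
        ≡⟨ cong₂ (λ x z → (s - x * w) + (- r) * (z - l * w)) (RHS*leibniz n) (sym (altSum-recipOdd n)) ⟩
      (s - seq C (suc n) * w) + (- r) * (altSum n recipOdd - l * w)   ∎
      where
      open ≡-Reasoning
      s = altSum n (summand a b c)
      r = seq RHS (suc n)
      l = leibnizSum (suc n)
      w = weight₀ n

    summand-null : IsNull (λ n → altSum n (summand a b c) - seq C (suc n) * weight₀ n)
    summand-null = altSum-toeplitz C-isAltSeries (isCauchy C)

    leibniz-null : IsNull (λ n → altSum n recipOdd - leibnizSum (suc n) * weight₀ n)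
    leibniz-null = altSum-toeplitz leibniz-isAltSeries leibnizSum-cauchy

  t⋆≃barSums : T⋆ ≃ RHS
  t⋆≃barSums = ≃-from-null T⋆ RHS summand-null leibniz-null error

theorem4p4 : (a b c : ℕ) → 1 ℕ.≤ c →
    t⋆ (replicate a 2 ++ (c ℕ.+ 3) ∷ replicate b 2) (starIndex-admissible a b c)
    ≃ (-ᴿ (fromℚ (fromℕ 2) *ᴿ inv π π#0)) *ᴿ
    (∑[ i ← upTo (c ℕ.+ 2) ] (fromℚ (fromℕ (2 ℕ.^ suc i)) *ᴿ
    (∑[ s ← compositions (suc i) (c ℕ.+ 2) ] (t (barIndex a b (parts s)) (barIndex-converges a b s)))))
theorem4p4 a b c _ = t⋆≃barSums a b c
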